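{- Let $A$ be a finite nonempty subset of $\mathbb Z_{>0}$ and let $\mathcal R=\{1,3,5,\dots,m\}\cap A$, where $m\ge 1$ is an odd number. Let $\psi:\mathcal T_A\to\mathcal R\mathcal{DC}_A$ be the map sending $T$ to the cycle $(\operatorname{pw}(\hat T))$ in the symmetric group $\mathfrak S_A$. Then $\psi$ is a well-defined bijection. Consequently $|\mathcal T_A|=|\mathcal R\mathcal{DC}_A|$.
   Context: $\mathcal R$-DID trees: a tree $T$ whose vertices are positive integers is an $\mathcal R$-deformed increasing-decreasing ($\mathcal R$-DID) tree if, when $T$ is rooted at its smallest vertex, each internal vertex $v$ (vertex with at least one child) satisfies: (i) if $v$ is odd and $v\in\mathcal R$, then $v$ is less than all of its descendants, and each child of $v$ is either even or an odd vertex in $\mathcal R$; (ii) if $v$ is odd and $v\notin\mathcal R$, then $v$ is less than all of its descendants and all of its children are even; (iii) if $v$ is even, then $v$ is greater than all of its descendants and all of its children are odd and not in $\mathcal R$. $\mathcal T_A$ is the set of $\mathcal R$-DID trees with vertex set $A$. $\hat T$: for an $\mathcal R$-DID tree $T$, $\hat T$ is the plane tree obtained by rooting $T$ at its smallest vertex and ordering the children of each vertex $v$ from left to right as follows: if $v$ is even, its children in increasing order; if $v$ is odd and $v\notin\mathcal R$, its children in decreasing order; if $v\in\mathcal R$, first the children belonging to $\mathcal R$ in increasing order, then the even children in decreasing order. Postorder word: for a plane tree $T$ with root $r$ and subtrees $T_1,\dots,T_k$ (left to right) rooted at the children of $r$, $\operatorname{pw}(T)=\operatorname{pw}(T_1)\cdots\operatorname{pw}(T_k)\,r$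 (concatenation), and $\operatorname{pw}(T)=r$ if $T$ has a single vertex. For a word $w=w_1\cdots w_\ell$ containing each element of $A$ exactly once, $(w)$ denotes the cyclic permutation $w_1\mapsto w_2\mapsto\cdots\mapsto w_\ell\mapsto w_1$ of $A$. An $\mathcal R$-D-permutation on $A$ is a permutation $\sigma$ of $A$ with $i\le\sigma(i)$ whenever $i$ is odd and $i\notin\mathcal R$, and $i\ge\sigma(i)$ whenever $i$ is even. $\mathcal R\mathcal{DC}_A$ is the set of $\mathcal R$-D-cycles on $A$, i.e. $\mathcal R$-D-permutations on $A$ consisting of a single cycle of length $|A|$. -}

module Defs where

open import Data.Bool.Base using (Bool; T; if_then_else_)
open import Data.Bool.Properties using (T?)
open import Data.Fin.Base as Fin using (Fin; zero)
import Data.Fin.Properties as Fin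
open import Data.Fin.Permutation as Perm using (Permutation′; _⟨$⟩ʳ_)
open import Data.List.Base using (List; []; _∷_; _++_; _∷ʳ_; map; filter; reverse; length; allFin)
open import Data.List.Membership.Propositional using (_∈_)
open import Data.List.Relation.Unary.All using (All)
open import Data.List.Relation.Unary.Linked using (Linked)
open import Data.List.Relation.Unary.Unique.Propositional using (Unique)
open import Data.Maybe.Base using (Maybe; just; nothing)
import Data.Maybe.Properties as Maybe
open import Data.Nat.Base using (ℕ; suc; _≤_; _<_)
open import Data.Nat.Divisibility using (_∣_; _∣?_)
open import Data.Nat.Properties using (_≤?_)
open import Data.Product.Base using (∃; _×_)
open import Data.Sum.Base using (_⊎_)
open import Function.Bundles using (Inverse)
open import Level using (0ℓ)
open import Relation.Binary.Bundles using (Setoid)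
open import Relation.Binary.Construct.Closure.ReflexiveTransitive using (Star)
open import Relation.Binary.PropositionalEquality.Core using (_≡_; refl; sym; trans)
open import Relation.Binary.PropositionalEquality.Properties using (setoid)
open import Relation.Nullary.Decidable.Core using (Dec; does; _×-dec_; ¬?)
open import Relation.Nullary.Negation.Core using (¬_)

Even : ℕ → Set
Even n = 2 ∣ n

Odd : ℕ → Set
Odd n = ¬ Even n

-- A finite nonempty set of positive integers, given by its increasing
-- enumeration.  Elements are referred to by their index, so permutations of
-- the set are `Permutation′ size`; `zero` is the index of the smallest element.
record FinitePositiveSet : Set where
  field
    predSize : ℕ

  size : ℕ
  size = suc predSize

  field
    element    : Fin size → ℕ
    positive   : ∀ i → 0 < element i
    increasing : ∀ {i j} → i Fin.< j → element i < element j

-- A labelled, unrooted tree: a connected acyclic simple graph on `Fin n`.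
record Tree (n : ℕ) : Set where
  field
    edge : Fin n → Fin n → Bool

  Adj : Fin n → Fin n → Set
  Adj v w = T (edge v w)

  field
    symmetric   : ∀ v w → edge v w ≡ edge w v
    irreflexive : ∀ v → ¬ Adj v v
    connected   : ∀ v w → Star Adj v w
    -- A cycle has at least three vertices: v followed by at least two others.
    acyclic     : ∀ v ws → 2 ≤ length ws → Unique (v ∷ ws) →
                  ¬ Linked Adj (v ∷ ws ∷ʳ v)

data PlaneTree (V : Set) : Set where
  node : V → List (PlaneTree V) → PlaneTree V

module _ {V : Set} where

  root : PlaneTree V → V
  root (node v _) = v

  mutual
    pw : PlaneTree V → List V
    pw (node v ts) = pwForest ts ∷ʳ v

    pwForest : List (PlaneTree V) → List V
    pwForest []       = []
    pwForest (t ∷ ts) = pw t ++ pwForest ts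

module _ {n : ℕ} where

  -- In increasing order, because `allFin` is.
  childrenOf : Tree n → Maybe (Fin n) → Fin n → List (Fin n)
  childrenOf t parent v =
    filter (λ w → T? (Tree.edge t v w) ×-dec ¬? (Maybe.≡-dec Fin._≟_ (just w) parent))
           (allFin n)

  -- The part of t at and below v when t is rooted so that v has the given
  -- parent; the first argument reorders the children of each vertex.  The
  -- number d bounds the height, and d = n (indeed n ∸ 1) never truncates.
  planeFrom : (Fin n → List (Fin n) → List (Fin n)) →
              Tree n → (d : ℕ) → Maybe (Fin n) → Fin n → PlaneTree (Fin n)
  planeFrom order t ℕ.zero  parent v = node v []
  planeFrom order t (suc d) parent v =
    node v (map (planeFrom order t d (just v)) (order v (childrenOf t parent v)))

  rotate : List (Fin n) → List (Fin n)
  rotate []       = []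
  rotate (x ∷ xs) = xs ∷ʳ x

  -- w is a word in which each element occurs exactly once, and σ is the cyclic
  -- permutation (w).
  record _IsCycle_ (σ : Permutation′ n) (w : List (Fin n)) : Set where
    field
      unique   : Unique w
      complete : ∀ v → v ∈ w
      cyclic   : map (σ ⟨$⟩ʳ_) w ≡ rotate w

-- Here ℛ = {1, 3, …, m} ∩ A.
module _ (A : FinitePositiveSet) (m : ℕ) where
  open FinitePositiveSet A

  Vertex : Set
  Vertex = Fin size

  EvenV OddV ℛ : Vertex → Set
  EvenV v = Even (element v)
  OddV  v = Odd (element v)
  ℛ     v = OddV v × element v ≤ m

  even? : ∀ v → Dec (EvenV v)
  even? v = 2 ∣? element v

  ℛ? : ∀ v → Dec (ℛ v)
  ℛ? v = ¬? (even? v) ×-dec (element v ≤? m)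

  -- The conditions at a vertex v in terms of its children and its descendants;
  -- they hold vacuously when v has no children.
  record DIDCondition (v : Vertex) (children descendants : List Vertex) : Set where
    field
      odd-ℛ  : OddV v → ℛ v →
               All (λ d → element v < element d) descendants ×
               All (λ c → EvenV c ⊎ (OddV c × ℛ c)) children
      odd-¬ℛ : OddV v → ¬ ℛ v →
               All (λ d → element v < element d) descendants ×
               All EvenV children
      even   : EvenV v →
               All (λ d → element d < element v) descendants ×
               All (λ c → OddV c × ¬ ℛ c) children

  -- `pwForest ts` lists all proper descendants of v.
  data IsDID : PlaneTree Vertex → Set where
    node : ∀ {v ts} → DIDCondition v (map root ts) (pwForest ts) →
           All IsDID ts → IsDID (node v ts)

  rooted : Tree size → PlaneTree Vertex
  rooted t = planeFrom (λ _ cs → cs) t size nothing zero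

  -- Reorders an increasing list of children of v.
  hatOrder : Vertex → List Vertex → List Vertex
  hatOrder v cs =
    if does (even? v) then cs
    else if does (ℛ? v) then filter ℛ? cs ++ reverse (filter even? cs)
    else reverse cs

  hat : Tree size → PlaneTree Vertex
  hat t = planeFrom hatOrder t size nothing zero

  record DIDTree : Set where
    field
      tree  : Tree size
      isDID : IsDID (rooted tree)

  record IsDPermutation (σ : Permutation′ size) : Set where
    field
      odd-¬ℛ : ∀ i → OddV i → ¬ ℛ i → element i ≤ element (σ ⟨$⟩ʳ i)
      even   : ∀ i → EvenV i → element (σ ⟨$⟩ʳ i) ≤ element i

  record DCycle : Set where
    field
      perm           : Permutation′ size
      isDPermutation : IsDPermutation perm
      isCycle        : ∃ λ w → perm IsCycle w

  𝒯 : Setoid 0ℓ 0ℓ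
  𝒯 = record
    { Carrier       = DIDTree
    ; _≈_           = λ s t → ∀ v w → edge s v w ≡ edge t v w
    ; isEquivalence = record
      { refl  = λ _ _ → refl
      ; sym   = λ p v w → sym (p v w)
      ; trans = λ p q v w → trans (p v w) (q v w)
      }
    }
    where
    edge : DIDTree → Vertex → Vertex → Bool
    edge t = Tree.edge (DIDTree.tree t)

  ℛ𝒟𝒞 : Setoid 0ℓ 0ℓ
  ℛ𝒟𝒞 = record
    { Carrier       = DCycle
    ; _≈_           = λ σ τ → DCycle.perm σ Perm.≈ DCycle.perm τ
    ; isEquivalence = record
      { refl  = λ _ → refl
      ; sym   = λ p i → sym (p i)
      ; trans = λ p q i → trans (p i) (q i)
      }
    }

HasCardinality : Setoid 0ℓ 0ℓ → ℕ → Set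
HasCardinality S c = Inverse S (setoid (Fin c))

{-# OPTIONS --safe #-}
module Submission where

-- Below a vertex v, T̂ lists siblings along a strict total order on all vertices
-- that depends only on the class of v (even, in ℛ, or odd and not in ℛ), and the
-- DID conditions make the root of each subtree precede, in this order, every
-- letter after the start of that subtree's word.  So the first root is the least
-- letter of the word of a forest: the word splits uniquely as u c w with u the
-- word of the children of c and w that of the remaining siblings, which gives
-- injectivity.  Conversely, splitting a word at its least letter rebuilds a
-- forest.  The conditions a < σ(a) for odd a outside ℛ and a > σ(a) for even a,
-- applied to the letter after c, force c to be an admissible child, and they
-- pass to u and w.  Rotating the smallest element to the end turns cycles into
-- such words.

open import Defs
open import Data.Bool.Base using (T; if_then_else_; true; false)
open import Data.Fin.Base as Fin using (Fin; zero; suc)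
open import Data.Fin.Permutation as Perm using (Permutation′; permutation; _⟨$⟩ʳ_)
import Data.Fin.Properties as Fin
open import Data.List.Base
  using (List; []; _∷_; _++_; _∷ʳ_; map; length; lookup; reverse; _ʳ++_; head; allFin;
         filter; cartesianProductWith; deduplicate)
open import Data.List.Membership.Propositional using (_∈_; _∉_; find; lose)
open import Data.List.Membership.Propositional.Properties
  using (∈-lookup; ∈-++⁺ʳ; ∈-++⁺ˡ; ∈-++⁻; ∈-map⁺; ∈-map⁻; ∈-filter⁺; ∈-filter⁻;
         ∈-allFin; ∈-∃++; ∈-length; ∈-cartesianProductWith⁺)
open import Data.List.Properties
  using (∷-injective; unfold-reverse; length-++; ++-assoc; ∷ʳ-injectiveʳ; map-∘;
         map-id; map-cong; filter-≐; map-id-local; map-++; map-cong-local;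
         ++-identityʳ; length-++-comm; ∷-injectiveˡ; ∷-injectiveʳ; ∷ʳ-++)
open import Data.List.Relation.Binary.Subset.Propositional using (_⊆_)
open import Data.List.Relation.Unary.All as All using (All; []; _∷_)
import Data.List.Relation.Unary.All.Properties as All
open import Data.List.Relation.Unary.AllPairs as AllPairs using (AllPairs; []; _∷_)
import Data.List.Relation.Unary.AllPairs.Properties as AllPairs
open import Data.List.Relation.Unary.Any as Any using (Any; here; there)
open import Data.List.Relation.Unary.Any.Properties as Any using (lookup-index)
open import Data.List.Relation.Unary.Enumerates.Setoid using (IsEnumeration)
open import Data.List.Relation.Unary.Enumerates.Setoid.Properties using (deduplicate⁺)
open import Data.List.Relation.Unary.Linked as Linked using (Linked; []; [-]; _∷_)
import Data.List.Relation.Unary.Unique.DecPropositional as Unique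
open import Data.List.Relation.Unary.Unique.DecSetoid.Properties using (deduplicate-!)
open import Data.List.Relation.Unary.Unique.Propositional using (Unique)
import Data.List.Relation.Unary.Unique.Propositional.Properties as Unique
open import Data.Maybe.Base using (Maybe; just; nothing)
open import Data.Maybe.Properties using (just-injective)
open import Data.Nat.Base using (_≤_; suc; _<_; s≤s; ℕ; zero; _+_; z≤n; _∸_; _≥_)
open import Data.Nat.Properties
  using (m≤m+n; m≤n+m; +-comm; ≤-trans; +-identityʳ; +-suc; m∸n+n≡m; <⇒≤; n≤1+n;
         <-trans; <-irrefl; <-≤-trans; ≤-pred; suc-injective; <-asym; <⇒≱; ≤-<-trans;
         ≤-refl; ≰⇒>; ≤∧≢⇒<; _≤?_; ≤⇒≯)
open import Data.Product.Base using (_×_; _,_; proj₁; proj₂; ∃; ∃₂)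
open import Data.Sum.Base as Sum using (_⊎_; inj₁; inj₂; swap)
open import Data.Unit.Base using (tt)
open import Function.Base using (_∘_; flip; id)
open import Function.Bundles using (mk⇔; Bijection)
open import Function.Construct.Composition using (inverse)
open import Function.Properties.Bijection using (Bijection⇒Inverse)
open import Level using (0ℓ)
open import Relation.Binary.Bundles using (Setoid; DecSetoid)
open import Relation.Binary.Construct.Closure.ReflexiveTransitive as Star
  using (Star; ε; _◅_; _◅◅_)
open import Relation.Binary.Core using (Rel)
open import Relation.Binary.Definitions
  using (Asymmetric; Symmetric; Transitive; DecidableEquality; tri<; tri≈; tri>)
open import Relation.Binary.PropositionalEquality
  using (_≡_; _≢_; refl; sym; trans; cong; cong₂; subst; ≢-sym)
open import Relation.Nullary.Decidable
  using (yes; no; Dec; does; map′; _⊎-dec_; does-⇔; _×-dec_; _→-dec_; ¬?)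
open import Relation.Nullary.Negation using (¬_; contradiction)

-- The inequalities between consecutive letters alone do not survive the splitting. A piece of a
-- word must also remember its bound by the parent and, below a parent outside ℛ, the absence of
-- letters of ℛ. That ℛ is an initial segment of the odd elements enters twice: an odd letter
-- outside ℛ exceeds every letter of ℛ, and a smallest element that is odd and outside ℛ leaves ℛ
-- empty. The other obstacle is that `rooted` and `hat` are computed separately from an unrooted
-- graph, and `hatOrder` discards the odd children outside ℛ of a vertex in ℛ. That both plane trees
-- have the same vertices and the same parents is therefore a consequence of the DID conditions,
-- obtained from the relation `≼` in both directions. Distinctness of labels and completeness come
-- from walks without backtracking, which are unique in a tree. For the cardinalities only cycles
-- are counted, by the words that describe them; trees inherit the count through the bijection.

-- Lists: pairwise and consecutive relations, splitting at a letter

module _ {A : Set} {R : Rel A 0ℓ} where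

  AllPairs-++⁻ : ∀ xs {ys} → AllPairs R (xs ++ ys) →
                 AllPairs R xs × AllPairs R ys × All (λ x → All (R x) ys) xs
  AllPairs-++⁻ []       rs       = [] , rs , []
  AllPairs-++⁻ (x ∷ xs) (r ∷ rs) =
    let rxs , rys , rxys = AllPairs-++⁻ xs rs in
    All.++⁻ˡ xs r ∷ rxs , rys , All.++⁻ʳ xs r ∷ rxys

  AllPairs-reverse : ∀ {xs} → AllPairs R xs → AllPairs (flip R) (reverse xs)
  AllPairs-reverse []                = []
  AllPairs-reverse {x ∷ xs} (r ∷ rs) =
    subst (AllPairs (flip R)) (sym (unfold-reverse x xs))
      (AllPairs.++⁺ (AllPairs-reverse rs) ([] ∷ [])
        (All.map (_∷ []) (All.anti-mono (Any.reverse⁻ {xs = xs}) r)))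

  -- If the heads differed, each would lie in the tail of the other list, so that `R` would hold
  -- both ways. This later identifies an arranged list of children with the roots of a given forest.
  AllPairs-⊆-antisym : Asymmetric R → ∀ {xs ys} → AllPairs R xs → AllPairs R ys →
                       xs ⊆ ys → ys ⊆ xs → xs ≡ ys
  AllPairs-⊆-antisym asym {[]}     {[]}     _ _ _ _ = refl
  AllPairs-⊆-antisym asym {[]}     {y ∷ ys} _ _ _ q with () ← q (here refl)
  AllPairs-⊆-antisym asym {x ∷ xs} {[]}     _ _ p _ with () ← p (here refl)
  AllPairs-⊆-antisym asym {x ∷ xs} {y ∷ ys} (rx ∷ rxs) (ry ∷ rys) p q
    with x≡y (p (here refl)) (q (here refl))
    where
    x≡y : x ∈ y ∷ ys → y ∈ x ∷ xs → x ≡ y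
    x≡y (here eq)  _          = eq
    x≡y (there _)  (here eq)  = sym eq
    x≡y (there x∈) (there y∈) = contradiction (All.lookup rx y∈) (asym (All.lookup ry x∈))
  ... | refl = cong (x ∷_) (AllPairs-⊆-antisym asym rxs rys (tail⊆ rx p) (tail⊆ ry q))
    where
    tail⊆ : ∀ {us vs} → All (R x) us → x ∷ us ⊆ x ∷ vs → us ⊆ vs
    tail⊆ rus s u∈ with s (there u∈)
    ... | here refl = contradiction (All.lookup rus u∈) (asym (All.lookup rus u∈))
    ... | there v∈  = v∈

  Linked-++⁻ : ∀ us {c ws} → Linked R (us ++ c ∷ ws) → Linked R (us ∷ʳ c) × Linked R (c ∷ ws)
  Linked-++⁻ []           l       = [-] , l
  Linked-++⁻ (u ∷ [])     (r ∷ l) = r ∷ [-] , l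
  Linked-++⁻ (u ∷ v ∷ us) (r ∷ l) = let l₁ , l₂ = Linked-++⁻ (v ∷ us) l in r ∷ l₁ , l₂

  Linked-++⁺ : ∀ us {c ws} → Linked R (us ∷ʳ c) → Linked R (c ∷ ws) → Linked R (us ++ c ∷ ws)
  Linked-++⁺ []           _       l₂ = l₂
  Linked-++⁺ (u ∷ [])     (r ∷ _) l₂ = r ∷ l₂
  Linked-++⁺ (u ∷ v ∷ us) (r ∷ l) l₂ = r ∷ Linked-++⁺ (v ∷ us) l l₂

  -- The result is a splitting at the minimum, since decoding recurses on both sides of it.
  -- Uniqueness separates `x` from the minimum of the tail, which makes the two comparable.
  least : Transitive R → (∀ {x y} → x ≢ y → R x y ⊎ R y x) →
          ∀ x xs → Unique (x ∷ xs) →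
          ∃ λ us → ∃₂ λ c ws → x ∷ xs ≡ us ++ c ∷ ws × All (R c) us × All (R c) ws
  least tr conn x []       _          = [] , x , [] , refl , [] , []
  least tr conn x (y ∷ xs) (x∉ ∷ xs!) with least tr conn y xs xs!
  ... | us , c , ws , eq , c<us , c<ws
    with conn (All.lookup x∉ (subst (c ∈_) (sym eq) (∈-++⁺ʳ us (here refl))))
  ...   | inj₂ c<x = x ∷ us , c , ws , cong (x ∷_) eq , c<x ∷ c<us , c<ws
  ...   | inj₁ x<c = [] , x , y ∷ xs , refl , [] ,
    subst (All (R x)) (sym eq)
      (All.++⁺ (All.map (tr x<c) c<us) (x<c ∷ All.map (tr x<c) c<ws))

module _ {A : Set} where

  Unique-++⇒disjoint : ∀ (xs : List A) {ys} → Unique (xs ++ ys) → ∀ {z} → z ∈ xs → z ∉ ys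
  Unique-++⇒disjoint xs xys! z∈xs z∈ys =
    All.lookup (All.lookup (proj₂ (proj₂ (AllPairs-++⁻ xs xys!))) z∈xs) z∈ys refl

  Unique-split : ∀ us us′ {c : A} {ws ws′} → Unique (us ++ c ∷ ws) →
                 us ++ c ∷ ws ≡ us′ ++ c ∷ ws′ → us ≡ us′ × ws ≡ ws′
  Unique-split []       []         _       refl = refl , refl
  Unique-split []       (_ ∷ us′)  (c∉ ∷ _) refl =
    contradiction refl (All.lookup c∉ (∈-++⁺ʳ us′ (here refl)))
  Unique-split (_ ∷ us) []         (c∉ ∷ _) refl =
    contradiction refl (All.lookup c∉ (∈-++⁺ʳ us (here refl)))
  Unique-split (u ∷ us) (u′ ∷ us′) (_ ∷ !)  eq with refl , eq′ ← ∷-injective eq =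
    let us≡ , ws≡ = Unique-split us us′ ! eq′ in cong (u ∷_) us≡ , ws≡

AllPairs-lookup-injective : {A : Set} {_≈_ : Rel A 0ℓ} → Symmetric _≈_ →
                            ∀ {xs} → AllPairs (λ x y → ¬ x ≈ y) xs →
                            ∀ {i j} → lookup xs i ≈ lookup xs j → i ≡ j
AllPairs-lookup-injective sy {x ∷ xs} _         {zero}  {zero}  _  = refl
AllPairs-lookup-injective sy {x ∷ xs} (x∉ ∷ _)  {zero}  {suc j} eq = contradiction eq (All.lookup x∉ (∈-lookup j))
AllPairs-lookup-injective sy {x ∷ xs} (x∉ ∷ _)  {suc i} {zero}  eq = contradiction (sy eq) (All.lookup x∉ (∈-lookup i))
AllPairs-lookup-injective sy {x ∷ xs} (_ ∷ xs!) {suc i} {suc j} eq = cong suc (AllPairs-lookup-injective sy xs! eq)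

Unique⇒length≤ : ∀ {n} {xs : List (Fin n)} → Unique xs → length xs ≤ n
Unique⇒length≤ xs! = Fin.injective⇒≤ (AllPairs-lookup-injective sym xs!)

-- Plane trees

module _ {V : Set} where

  private variable
    x v w c       : V
    s t u         : PlaneTree V
    ts us fs gs   : List (PlaneTree V)

  infix 4 _∈ᵀ_ _≼_

  data _∈ᵀ_ (s : PlaneTree V) : PlaneTree V → Set where
    here  : s ∈ᵀ s
    there : Any (s ∈ᵀ_) ts → s ∈ᵀ node v ts

  -- s ≼ t: up to the order of siblings, s is obtained from t by deleting
  -- subtrees.
  data _≼_ : PlaneTree V → PlaneTree V → Set where
    node : All (λ t → Any (t ≼_) us) ts → node v ts ≼ node v us

  ParentOf : PlaneTree V → V → V → Set
  ParentOf t v w = ∃ λ ts → node v ts ∈ᵀ t × w ∈ map root ts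

  children : PlaneTree V → List (PlaneTree V)
  children (node _ ts) = ts

  root∈pw : ∀ (t : PlaneTree V) → root t ∈ pw t
  root∈pw (node v ts) = ∈-++⁺ʳ (pwForest ts) (here refl)

  ∈-pwForest⁺ : Any (λ t → x ∈ pw t) ts → x ∈ pwForest ts
  ∈-pwForest⁺          (here x∈)  = ∈-++⁺ˡ x∈
  ∈-pwForest⁺ {ts = t ∷ _} (there x∈) = ∈-++⁺ʳ (pw t) (∈-pwForest⁺ x∈)

  ∈-pwForest⁻ : ∀ (ts : List (PlaneTree V)) → x ∈ pwForest ts → Any (λ t → x ∈ pw t) ts
  ∈-pwForest⁻ (t ∷ ts) x∈ with ∈-++⁻ (pw t) x∈
  ... | inj₁ x∈t  = here x∈t
  ... | inj₂ x∈ts = there (∈-pwForest⁻ ts x∈ts)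

  ∈-pw⁻ : ∀ (ts : List (PlaneTree V)) → x ∈ pw (node v ts) → x ∈ pwForest ts ⊎ x ≡ v
  ∈-pw⁻ ts x∈ with ∈-++⁻ (pwForest ts) x∈
  ... | inj₁ x∈ts        = inj₁ x∈ts
  ... | inj₂ (here refl) = inj₂ refl

  roots⊆pwForest : ∀ (ts : List (PlaneTree V)) → map root ts ⊆ pwForest ts
  roots⊆pwForest (t ∷ ts) (here refl) = ∈-++⁺ˡ (root∈pw t)
  roots⊆pwForest (t ∷ ts) (there x∈)  = ∈-++⁺ʳ (pw t) (roots⊆pwForest ts x∈)

  pw-node⁻ : ∀ ts → Unique (pw (node v ts)) → v ∉ pwForest ts × Unique (pwForest ts)
  pw-node⁻ ts ! = (λ v∈ → Unique-++⇒disjoint (pwForest ts) ! v∈ (here refl)) ,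
                        proj₁ (AllPairs-++⁻ (pwForest ts) !)

  pwForest-∷⁻ : ∀ (t : PlaneTree V) ts → Unique (pwForest (t ∷ ts)) → Unique (pw t) × Unique (pwForest ts)
  pwForest-∷⁻ t ts ! = let !t , !ts , _ = AllPairs-++⁻ (pw t) ! in !t , !ts

  mutual
    ∈ᵀ⇒pw⊆ : s ∈ᵀ t → pw s ⊆ pw t
    ∈ᵀ⇒pw⊆ here       x∈ = x∈
    ∈ᵀ⇒pw⊆ (there s∈) x∈ = ∈-++⁺ˡ (∈ᵀ⇒pw⊆pwForest s∈ x∈)

    ∈ᵀ⇒pw⊆pwForest : Any (s ∈ᵀ_) ts → pw s ⊆ pwForest ts
    ∈ᵀ⇒pw⊆pwForest                (here s∈)  x∈ = ∈-++⁺ˡ (∈ᵀ⇒pw⊆ s∈ x∈)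
    ∈ᵀ⇒pw⊆pwForest {ts = t ∷ ts} (there s∈) x∈ = ∈-++⁺ʳ (pw t) (∈ᵀ⇒pw⊆pwForest s∈ x∈)

  ∈ᵀ⇒descendants⊆ : node w us ∈ᵀ node v ts → pwForest us ⊆ pwForest ts
  ∈ᵀ⇒descendants⊆ here       x∈ = x∈
  ∈ᵀ⇒descendants⊆ (there s∈) x∈ = ∈ᵀ⇒pw⊆pwForest s∈ (∈-++⁺ˡ x∈)

  mutual
    ∈ᵀ-trans : s ∈ᵀ t → t ∈ᵀ u → s ∈ᵀ u
    ∈ᵀ-trans p here       = p
    ∈ᵀ-trans p (there q)  = there (∈ᵀ-transForest p q)

    ∈ᵀ-transForest : s ∈ᵀ t → Any (t ∈ᵀ_) us → Any (s ∈ᵀ_) us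
    ∈ᵀ-transForest p (here q)  = here (∈ᵀ-trans p q)
    ∈ᵀ-transForest p (there q) = there (∈ᵀ-transForest p q)

  child∈ᵀ : node v ts ∈ᵀ t → s ∈ ts → s ∈ᵀ t
  child∈ᵀ p s∈ = ∈ᵀ-trans (there (lose s∈ here)) p

  mutual
    subtreeAt : ∀ (t : PlaneTree V) → x ∈ pw t → ∃ λ ts → node x ts ∈ᵀ t
    subtreeAt (node v ts) x∈ with ∈-pw⁻ ts x∈
    ... | inj₁ x∈ts = let us , p = subtreeAtForest ts x∈ts in us , there p
    ... | inj₂ refl = ts , here

    subtreeAtForest : ∀ (ts : List (PlaneTree V)) → x ∈ pwForest ts → ∃ λ us → Any (node x us ∈ᵀ_) ts
    subtreeAtForest (t ∷ ts) x∈ with ∈-++⁻ (pw t) x∈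
    ... | inj₁ x∈t  = let us , p = subtreeAt t x∈t in us , here p
    ... | inj₂ x∈ts = let us , p = subtreeAtForest ts x∈ts in us , there p

  mutual
    -- Two different occurrences of the label `x` would put it twice into the postorder word.
    subtree-unique : Unique (pw t) →
                     node x ts ∈ᵀ t → node x us ∈ᵀ t → ts ≡ us
    subtree-unique {t = node _ fs} ! here      here      = refl
    subtree-unique {t = node x fs} {us = us} ! here (there q) =
      contradiction (∈ᵀ⇒pw⊆pwForest q (root∈pw (node x us))) (proj₁ (pw-node⁻ fs !))
    subtree-unique {t = node x fs} {ts = ts} ! (there p) here =
      contradiction (∈ᵀ⇒pw⊆pwForest p (root∈pw (node x ts))) (proj₁ (pw-node⁻ fs !))
    subtree-unique {t = node _ fs} ! (there p) (there q) = subtree-uniqueForest (proj₂ (pw-node⁻ fs !)) p q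

    subtree-uniqueForest : Unique (pwForest fs) →
                           Any (node x ts ∈ᵀ_) fs → Any (node x us ∈ᵀ_) fs → ts ≡ us
    subtree-uniqueForest {fs = f ∷ fs} ! (here p)  (here q)  = subtree-unique (proj₁ (pwForest-∷⁻ f fs !)) p q
    subtree-uniqueForest {fs = f ∷ fs} ! (there p) (there q) = subtree-uniqueForest (proj₂ (pwForest-∷⁻ f fs !)) p q
    subtree-uniqueForest {fs = f ∷ fs} {x = x} {ts = ts} {us = us} ! (here p)  (there q) = contradiction
      (∈ᵀ⇒pw⊆pwForest q (root∈pw (node x us))) (Unique-++⇒disjoint (pw f) ! (∈ᵀ⇒pw⊆ p (root∈pw (node x ts))))
    subtree-uniqueForest {fs = f ∷ fs} {x = x} {ts = ts} {us = us} ! (there p) (here q)  = contradiction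
      (∈ᵀ⇒pw⊆pwForest p (root∈pw (node x ts))) (Unique-++⇒disjoint (pw f) ! (∈ᵀ⇒pw⊆ q (root∈pw (node x us))))

  root-not-child : Unique (pw t) → ¬ ParentOf t v (root t)
  root-not-child {t = node _ fs} ! (ts , p , c∈) =
    contradiction (∈ᵀ⇒descendants⊆ p (roots⊆pwForest ts c∈)) (proj₁ (pw-node⁻ fs !))

  root-not-childForest : Unique (pwForest fs) → c ∈ map root fs →
                         Any (node v us ∈ᵀ_) fs → c ∉ map root us
  root-not-childForest {fs = f ∷ fs} {us = us} ! (here refl) (here p)  c∈ =
    root-not-child (proj₁ (pwForest-∷⁻ f fs !)) (us , p , c∈)
  root-not-childForest {fs = f ∷ fs} {us = us} ! (there c∈fs) (there p) c∈ =
    root-not-childForest (proj₂ (pwForest-∷⁻ f fs !)) c∈fs p c∈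
  root-not-childForest {fs = f ∷ fs} {us = us} ! (here refl) (there p) c∈ =
    Unique-++⇒disjoint (pw f) ! (root∈pw f) (∈ᵀ⇒pw⊆pwForest p (∈-++⁺ˡ (roots⊆pwForest us c∈)))
  root-not-childForest {fs = f ∷ fs} {us = us} ! (there c∈fs) (here p) c∈ =
    Unique-++⇒disjoint (pw f) ! (∈ᵀ⇒pw⊆ p (∈-++⁺ˡ (roots⊆pwForest us c∈))) (roots⊆pwForest fs c∈fs)

  mutual
    -- At the vertex where the two paths to `c` part, `c` would occur in two disjoint pieces of the
    -- word, or be both a root of a forest and a child inside it.
    parent-unique : Unique (pw t) → ParentOf t v c → ParentOf t w c → v ≡ w
    parent-unique {t = node _ fs} ! (ts , here , c∈)    (us , here , c∈′)    = refl
    parent-unique {t = node _ fs} ! (ts , here , c∈)    (us , there q , c∈′) =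
      contradiction c∈′ (root-not-childForest (proj₂ (pw-node⁻ fs !)) c∈ q)
    parent-unique {t = node _ fs} ! (ts , there p , c∈) (us , here , c∈′)    =
      contradiction c∈ (root-not-childForest (proj₂ (pw-node⁻ fs !)) c∈′ p)
    parent-unique {t = node _ fs} ! (ts , there p , c∈) (us , there q , c∈′) =
      parent-uniqueForest (proj₂ (pw-node⁻ fs !)) p c∈ q c∈′

    parent-uniqueForest : Unique (pwForest fs) →
                          Any (node v ts ∈ᵀ_) fs → c ∈ map root ts →
                          Any (node w us ∈ᵀ_) fs → c ∈ map root us → v ≡ w
    parent-uniqueForest {fs = f ∷ fs} ! (here p)  c∈ (here q)  c∈′ =
      parent-unique (proj₁ (pwForest-∷⁻ f fs !)) (_ , p , c∈) (_ , q , c∈′)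
    parent-uniqueForest {fs = f ∷ fs} ! (there p) c∈ (there q) c∈′ =
      parent-uniqueForest (proj₂ (pwForest-∷⁻ f fs !)) p c∈ q c∈′
    parent-uniqueForest {fs = f ∷ fs} {ts = ts} {us = us} ! (here p)  c∈ (there q) c∈′ = contradiction
      (∈ᵀ⇒pw⊆pwForest q (∈-++⁺ˡ (roots⊆pwForest us c∈′)))
      (Unique-++⇒disjoint (pw f) ! (∈ᵀ⇒pw⊆ p (∈-++⁺ˡ (roots⊆pwForest ts c∈))))
    parent-uniqueForest {fs = f ∷ fs} {ts = ts} {us = us} ! (there p) c∈ (here q)  c∈′ = contradiction
      (∈ᵀ⇒pw⊆pwForest p (∈-++⁺ˡ (roots⊆pwForest ts c∈)))
      (Unique-++⇒disjoint (pw f) ! (∈ᵀ⇒pw⊆ q (∈-++⁺ˡ (roots⊆pwForest us c∈′))))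

  length-pw-child : t ∈ ts → length (pw t) < length (pw (node v ts))
  length-pw-child {t = t} {ts = ts} t∈ = subst (length (pw t) <_)
    (sym (trans (length-++ (pwForest ts)) (+-comm _ 1))) (s≤s (go t∈))
    where
    go : ∀ {us} → t ∈ us → length (pw t) ≤ length (pwForest us)
    go {us = _ ∷ us} (here refl) = subst (length (pw t) ≤_) (sym (length-++ (pw t))) (m≤m+n _ _)
    go {us = u ∷ us} (there t∈)  = ≤-trans (go t∈) (subst (length (pwForest us) ≤_) (sym (length-++ (pw u))) (m≤n+m _ _))

  -- Word length serves as a rank that falls from parent to child. The forest `us` is given
  -- independently of `ts`, so `subtree-unique` has to match it with the child found there.
  child-smaller : Unique (pw t) → node v ts ∈ᵀ t → node w us ∈ᵀ t →
                  w ∈ map root ts → length (pw (node w us)) < length (pw (node v ts))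
  child-smaller {w = w} {us = us} ! p q w∈ with ∈-map⁻ root w∈
  ... | node _ xs , s∈ , refl =
    subst (λ ys → length (pw (node w ys)) < _) (subtree-unique ! (child∈ᵀ p s∈) q) (length-pw-child s∈)

  mutual
    ≼⇒pw⊆ : s ≼ t → pw s ⊆ pw t
    ≼⇒pw⊆ (node {us = us} {ts = ts} ps) x∈ with ∈-pw⁻ ts x∈
    ... | inj₁ x∈ts = ∈-++⁺ˡ (≼⇒pwForest⊆ ps x∈ts)
    ... | inj₂ refl = ∈-++⁺ʳ (pwForest us) (here refl)

    ≼⇒pwForest⊆ : All (λ t → Any (t ≼_) us) ts → pwForest ts ⊆ pwForest us
    ≼⇒pwForest⊆ {ts = t ∷ ts} (p ∷ ps) x∈ with ∈-++⁻ (pw t) x∈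
    ... | inj₁ x∈t  = ∈-pwForest⁺ (≼-Any p x∈t)
    ... | inj₂ x∈ts = ≼⇒pwForest⊆ ps x∈ts

    ≼-Any : Any (t ≼_) us → x ∈ pw t → Any (λ u → x ∈ pw u) us
    ≼-Any (here p)  x∈ = here (≼⇒pw⊆ p x∈)
    ≼-Any (there p) x∈ = there (≼-Any p x∈)

  ≼⇒roots⊆ : All (λ t → Any (t ≼_) us) ts → map root ts ⊆ map root us
  ≼⇒roots⊆ (p ∷ ps) (there x∈) = ≼⇒roots⊆ ps x∈
  ≼⇒roots⊆ (p ∷ ps) (here refl) = Any.map⁺ (Any.map (λ { (node _) → refl }) p)

  mutual
    ≼-subtree : s ≼ t → node v ts ∈ᵀ s → ∃ λ us → node v us ∈ᵀ t × node v ts ≼ node v us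
    ≼-subtree p@(node _) here   = _ , here , p
    ≼-subtree (node ps) (there q) = let us , r , p = ≼-subtreeForest ps q in us , there r , p

    ≼-subtreeForest : All (λ t → Any (t ≼_) gs) fs → Any (node v ts ∈ᵀ_) fs →
                      ∃ λ us → Any (node v us ∈ᵀ_) gs × node v ts ≼ node v us
    ≼-subtreeForest (p ∷ _)  (here q)  = ≼-subtreeAny p q
    ≼-subtreeForest (_ ∷ ps) (there q) = ≼-subtreeForest ps q

    ≼-subtreeAny : Any (s ≼_) gs → node v ts ∈ᵀ s →
                   ∃ λ us → Any (node v us ∈ᵀ_) gs × node v ts ≼ node v us
    ≼-subtreeAny (here p)  q = let us , r , s = ≼-subtree p q in us , here r , s
    ≼-subtreeAny (there p) q = let us , r , s = ≼-subtreeAny p q in us , there r , s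

  ≼⇒ParentOf : s ≼ t → ParentOf s v w → ParentOf t v w
  ≼⇒ParentOf p (ts , q , w∈) with ≼-subtree p q
  ... | us , r , node ps = us , r , ≼⇒roots⊆ ps w∈

-- Trees as graphs

module Trails {V : Set} (Adj : V → V → Set) where

  -- Walks that never step straight back.
  data Trail : List V → Set where
    [-]      : ∀ {x} → Trail (x ∷ [])
    [_]      : ∀ {x y} → Adj x y → Trail (x ∷ y ∷ [])
    _∷⟨_⟩_ : ∀ {x y z ws} → Adj x y → x ≢ z → Trail (y ∷ z ∷ ws) → Trail (x ∷ y ∷ z ∷ ws)

  Trail-tail : ∀ {x y ws} → Trail (x ∷ y ∷ ws) → Trail (y ∷ ws)
  Trail-tail [ _ ]           = [-]
  Trail-tail (_ ∷⟨ _ ⟩ tr) = tr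

  Trail-head : ∀ {x y ws} → Trail (x ∷ y ∷ ws) → Adj x y
  Trail-head [ a ]          = a
  Trail-head (a ∷⟨ _ ⟩ _) = a

  Trail⇒Linked : ∀ {ws} → Trail ws → Linked Adj ws
  Trail⇒Linked [-]              = [-]
  Trail⇒Linked [ a ]            = a ∷ [-]
  Trail⇒Linked (a ∷⟨ _ ⟩ tr) = a ∷ Trail⇒Linked tr

  end : V → List V → V
  end x []       = x
  end x (y ∷ ys) = end y ys

  end∈ : ∀ x xs → end x xs ∈ x ∷ xs
  end∈ x []       = here refl
  end∈ x (y ∷ ys) = there (end∈ y ys)

  end-++ : ∀ xs {u ws v ps} → u ∷ ws ≡ xs ++ v ∷ ps → end u ws ≡ end v ps
  end-++ []           refl = refl
  end-++ (_ ∷ [])     refl = refl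
  end-++ (_ ∷ x ∷ xs) refl = end-++ (x ∷ xs) refl

  -- `ys ʳ++ y ∷ tl` starts with the end of the walk `y ∷ ys`, and a first entry does not recur.
  end-ʳ++ : ∀ y ys {tl} → Unique (ys ʳ++ y ∷ tl) → end y ys ∉ tl
  end-ʳ++ y []        (y∉ ∷ _) y∈ = contradiction refl (All.lookup y∉ y∈)
  end-ʳ++ y (y′ ∷ ys) !        e∈ = end-ʳ++ y′ ys ! (there e∈)

  module _ (_≟_ : DecidableEquality V) where

    -- A new edge that would be undone by the next step cancels with it; otherwise it extends the
    -- trail.
    Star⇒Trail : ∀ {u v} → Star Adj u v → ∃ λ ws → Trail (u ∷ ws) × end u ws ≡ v
    Star⇒Trail ε = [] , [-] , refl
    Star⇒Trail (_◅_ {i = u} a s) with Star⇒Trail s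
    ... | []     , tr , eq = _ , [ a ] , eq
    ... | p ∷ ps , tr , eq with u ≟ p
    ...   | yes refl = ps , Trail-tail tr , eq
    ...   | no u≢p   = _ , a ∷⟨ u≢p ⟩ tr , eq

    module _ (symm : Symmetric Adj) (irrefl : ∀ {v} → ¬ Adj v v)
             (acyclic : ∀ v ws → 2 ≤ length ws → Unique (v ∷ ws) → ¬ Linked Adj (v ∷ ws ∷ʳ v))
             where

      -- The tail is free of repetitions by induction, so a return to the starting vertex closes a
      -- cycle. Not stepping straight back gives it the two further vertices that `acyclic` asks
      -- for.
      Trail⇒Unique : ∀ {ws} → Trail ws → Unique ws
      Trail⇒Unique [-]   = [] ∷ []
      Trail⇒Unique [ a ] = ((λ { refl → irrefl a }) ∷ []) ∷ [] ∷ []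
      Trail⇒Unique tr@(_∷⟨_⟩_ {x} {y} {z} {ws} a x≢z tr′) =
        ((λ { refl → irrefl a }) ∷ x≢z ∷ All.¬Any⇒All¬ ws x∉ws) ∷ tr′!
        where
        tr′! = Trail⇒Unique tr′
        x∉ws : x ∉ ws
        x∉ws x∈ with ∈-∃++ x∈
        ... | as , bs , refl =
          let yas! , _ , yas∌x = AllPairs-++⁻ (y ∷ z ∷ as) tr′! in
          acyclic x (y ∷ z ∷ as) (s≤s (s≤s z≤n))
            (All.map (λ { (p ∷ _) → ≢-sym p }) yas∌x ∷ yas!)
            (proj₁ (Linked-++⁻ (x ∷ y ∷ z ∷ as) (Trail⇒Linked tr)))

      -- The first trail is walked backwards and continued along the second. They overlap in the
      -- edge between `x` and `y`, so each turn of the combined walk already occurs in one of them.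
      Trail-ʳ++ : ∀ {x y zs} xs → Trail (x ∷ y ∷ xs) → Trail (y ∷ x ∷ zs) → Trail (xs ʳ++ y ∷ x ∷ zs)
      Trail-ʳ++ []       _                  tr = tr
      Trail-ʳ++ (z ∷ xs) (_ ∷⟨ x≢z ⟩ tr′) tr =
        Trail-ʳ++ xs tr′ (symm (Trail-head tr′) ∷⟨ ≢-sym x≢z ⟩ tr)

      -- Two different trails from x to the same end would combine, beyond
      -- their last common vertex, to a closed trail.
      Trail-unique : ∀ {x} ys zs → Trail (x ∷ ys) → Trail (x ∷ zs) → end x ys ≡ end x zs → ys ≡ zs
      Trail-unique []       []       _  _   _  = refl
      Trail-unique []       (z ∷ zs) _  tr′ eq with x∉ ∷ _ ← Trail⇒Unique tr′ =
        contradiction eq (All.lookup x∉ (end∈ z zs))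
      Trail-unique (y ∷ ys) []       tr _   eq with x∉ ∷ _ ← Trail⇒Unique tr =
        contradiction (sym eq) (All.lookup x∉ (end∈ y ys))
      Trail-unique (y ∷ ys) (z ∷ zs) tr tr′ eq with y ≟ z
      ... | yes refl = cong (y ∷_) (Trail-unique ys zs (Trail-tail tr) (Trail-tail tr′) eq)
      ... | no y≢z   = contradiction (there (subst (_∈ z ∷ zs) (sym eq) (end∈ z zs)))
        (end-ʳ++ y ys (Trail⇒Unique (Trail-ʳ++ ys tr (symm (Trail-head tr) ∷⟨ y≢z ⟩ tr′))))

-- Rooting a labelled tree

module _ {n : ℕ} where

  Order : Set
  Order = Fin n → List (Fin n) → List (Fin n)

  module _ (order : Order) (t : Tree n) where

    root-planeFrom : ∀ d p v → root (planeFrom order t d p v) ≡ v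
    root-planeFrom zero    p v = refl
    root-planeFrom (suc d) p v = refl

    roots-planeFrom : ∀ d p cs → map root (map (planeFrom order t d p) cs) ≡ cs
    roots-planeFrom d p cs =
      trans (sym (map-∘ cs)) (trans (map-cong (root-planeFrom d p) cs) (map-id cs))

  map-≼ : ∀ {cs cs′ : List (Fin n)} {f g : Fin n → PlaneTree (Fin n)} →
          (∀ {c} → c ∈ cs → c ∈ cs′ × f c ≼ g c) →
          All (λ t → Any (t ≼_) (map g cs′)) (map f cs)
  map-≼ h = All.map⁺ (All.tabulate λ c∈ → Any.map⁺ (lose (proj₁ (h c∈)) (proj₂ (h c∈))))

  planeFrom-≼ : ∀ {o o′ : Order} t → (∀ v {cs} → o v cs ⊆ o′ v cs) →
                ∀ d p v → planeFrom o t d p v ≼ planeFrom o′ t d p v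
  planeFrom-≼ t o⊆o′ zero    p v = node []
  planeFrom-≼ t o⊆o′ (suc d) p v = node (map-≼ λ c∈ → o⊆o′ v c∈ , planeFrom-≼ t o⊆o′ d (just v) _)

  planeFrom-cong : ∀ (o : Order) {s t : Tree n} → (∀ v w → Tree.edge s v w ≡ Tree.edge t v w) →
                   ∀ d p v → planeFrom o s d p v ≡ planeFrom o t d p v
  planeFrom-cong o s≈t zero    p v = refl
  planeFrom-cong o {s} {t} s≈t (suc d) p v = cong (node v) (trans
    (map-cong (planeFrom-cong o s≈t d (just v)) _)
    (cong (λ cs → map (planeFrom o t d (just v)) (o v cs))
      (filter-≐ _ _ ((λ (a , b) → subst T (s≈t v _) a , b) , (λ (a , b) → subst T (sym (s≈t v _)) a , b)) (allFin n))))

  module _ (t : Tree n) where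
    open Tree t
    open Trails Adj

    Adj-sym : Symmetric Adj
    Adj-sym = subst T (symmetric _ _)

    ∈-childrenOf⁺ : ∀ {p v c} → Adj v c → just c ≢ p → c ∈ childrenOf t p v
    ∈-childrenOf⁺ a c≢p = ∈-filter⁺ _ (∈-allFin _) (a , c≢p)

    ∈-childrenOf⁻ : ∀ {p v c} → c ∈ childrenOf t p v → Adj v c × just c ≢ p
    ∈-childrenOf⁻ c∈ = proj₂ (∈-filter⁻ _ {xs = allFin n} c∈)

    childrenOf-increasing : ∀ p v → AllPairs Fin._<_ (childrenOf t p v)
    childrenOf-increasing p v = AllPairs.filter⁺ _ (AllPairs.tabulate⁺-< id)

    -- When `v ∷ ps` leads up to the root, the parent of `v` is `head ps`, and excluding it from the
    -- children is exactly the ban on stepping back. `child-Trail` is the converse.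
    Trail-child : ∀ {v c} ps → Trail (v ∷ ps) → c ∈ childrenOf t (head ps) v → Trail (c ∷ v ∷ ps)
    Trail-child []       tr c∈ = [ Adj-sym (proj₁ (∈-childrenOf⁻ c∈)) ]
    Trail-child (p ∷ ps) tr c∈ =
      let a , c≢p = ∈-childrenOf⁻ c∈ in Adj-sym a ∷⟨ c≢p ∘ cong just ⟩ tr

    child-Trail : ∀ {v c} ps → Trail (c ∷ v ∷ ps) → c ∈ childrenOf t (head ps) v
    child-Trail []       tr                 = ∈-childrenOf⁺ (Adj-sym (Trail-head tr)) λ ()
    child-Trail (p ∷ ps) (a ∷⟨ c≢p ⟩ tr) = ∈-childrenOf⁺ (Adj-sym a) (c≢p ∘ just-injective)

    tree-Trail⇒Unique : ∀ {ws} → Trail ws → Unique ws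
    tree-Trail⇒Unique = Trail⇒Unique Fin._≟_ Adj-sym (irreflexive _) acyclic

    module _ {o : Order} (o⊆ : ∀ v {cs} → o v cs ⊆ cs) where

      -- The trail of a descendant runs through `v`; the prefix `xs` keeps the branch that it takes
      -- below `v`.
      planeFrom-Trail : ∀ d {u v} ps → Trail (v ∷ ps) → u ∈ pw (planeFrom o t d (head ps) v) →
                        ∃₂ λ ws xs → Trail (u ∷ ws) × u ∷ ws ≡ xs ++ v ∷ ps
      planeFrom-Trail zero    ps tr (here refl) = ps , [] , tr , refl
      planeFrom-Trail (suc d) {u} {v} ps tr u∈ with ∈-pw⁻ (map (planeFrom o t d (just v)) (o v (childrenOf t (head ps) v))) u∈
      ... | inj₂ refl = ps , [] , tr , refl
      ... | inj₁ u∈ts =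
        let c , c∈ , u∈c = find (Any.map⁻ (∈-pwForest⁻ (map (planeFrom o t d (just v)) _) u∈ts))
            ws , xs , tr′ , eq = planeFrom-Trail d (v ∷ ps) (Trail-child ps tr (o⊆ v c∈)) u∈c
        in ws , xs ∷ʳ c , tr′ , trans eq (sym (++-assoc xs _ _))

      planeFrom-ParentOf : ∀ d {p v a b} → ParentOf (planeFrom o t d p v) a b → Adj a b
      planeFrom-ParentOf zero (_ , there () , _)
      planeFrom-ParentOf (suc d) {p} {v} (_ , here , b∈) = proj₁ (∈-childrenOf⁻
        (o⊆ v (subst (_ ∈_) (roots-planeFrom o t d (just v) (o v (childrenOf t p v))) b∈)))
      planeFrom-ParentOf (suc d) (_ , there q , b∈) =
        let _ , _ , r = find (Any.map⁻ q) in planeFrom-ParentOf d (_ , r , b∈)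

      module _ (o! : ∀ p v → Unique (o v (childrenOf t p v))) where

        -- A repeated label would have two trails with the same end. These agree, so both
        -- occurrences lie below the same child of `v`, or `v` would lie strictly below itself.
        planeFrom-Unique : ∀ d v ps → Trail (v ∷ ps) → Unique (pw (planeFrom o t d (head ps) v))
        planeFrom-Unique zero    v ps tr = [] ∷ []
        planeFrom-Unique (suc d) v ps tr =
          Unique.++⁺ (forest! (o! (head ps) v) λ c∈ → c∈) ([] ∷ [])
            λ { (v∈ , here refl) → v∉ v∈ }
          where
          f : Fin n → PlaneTree (Fin n)
          f = planeFrom o t d (just v)

          below : ∀ {c u} → c ∈ o v (childrenOf t (head ps) v) → u ∈ pw (f c) →
                  ∃₂ λ ws xs → Trail (u ∷ ws) × u ∷ ws ≡ (xs ∷ʳ c) ++ v ∷ ps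
          below c∈ u∈ =
            let ws , xs , tr′ , eq = planeFrom-Trail d (v ∷ ps) (Trail-child ps tr (o⊆ v c∈)) u∈
            in ws , xs , tr′ , trans eq (sym (++-assoc xs _ _))

          v∉ : v ∉ pwForest (map f (o v (childrenOf t (head ps) v)))
          v∉ v∈ with find (Any.map⁻ (∈-pwForest⁻ (map f _) v∈))
          ... | c , c∈ , v∈c with below c∈ v∈c
          ...   | ws , xs , tr′ , eq with
                  Trail-unique Fin._≟_ Adj-sym (irreflexive _) acyclic ws ps tr′ tr (end-++ (xs ∷ʳ c) eq)
          ...     | refl with Unique-split [] (xs ∷ʳ c) (tree-Trail⇒Unique tr) eq
          -- The splitting yields `[] ≡ xs ∷ʳ c`, which is visibly absurd only once the shape of
          -- `xs` is known.
          v∉ v∈ | c , c∈ , v∈c | ws , [] , tr′ , eq | refl | () , _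
          v∉ v∈ | c , c∈ , v∈c | ws , _ ∷ _ , tr′ , eq | refl | () , _

          same-child : ∀ {c c′ u} → c ∈ o v (childrenOf t (head ps) v) → c′ ∈ o v (childrenOf t (head ps) v) →
                       u ∈ pw (f c) → u ∈ pw (f c′) → c ≡ c′
          same-child {c} {c′} c∈ c′∈ u∈ u∈′ with below c∈ u∈ | below c′∈ u∈′
          ... | ws , xs , tr₁ , eq₁ | ws′ , xs′ , tr₂ , eq₂
            with Trail-unique Fin._≟_ Adj-sym (irreflexive _) acyclic ws ws′ tr₁ tr₂
                   (trans (end-++ (xs ∷ʳ c) eq₁) (sym (end-++ (xs′ ∷ʳ c′) eq₂)))
          ...   | refl = ∷ʳ-injectiveʳ xs xs′ (proj₁ (Unique-split (xs ∷ʳ c) (xs′ ∷ʳ c′)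
                  (subst Unique eq₁ (tree-Trail⇒Unique tr₁)) (trans (sym eq₁) eq₂)))

          forest! : ∀ {cs} → Unique cs → cs ⊆ o v (childrenOf t (head ps) v) → Unique (pwForest (map f cs))
          forest! []                 _  = []
          forest! {c ∷ cs} (c∉ ∷ !) ⊆cs = Unique.++⁺
            (planeFrom-Unique d c (v ∷ ps) (Trail-child ps tr (o⊆ v (⊆cs (here refl)))))
            (forest! ! (⊆cs ∘ there))
            λ (u∈ , u∈′) → let c′ , c′∈ , u∈c′ = find (Any.map⁻ (∈-pwForest⁻ (map f cs) u∈′)) in
              contradiction (same-child (⊆cs (here refl)) (⊆cs (there c′∈)) u∈ u∈c′) (All.lookup c∉ c′∈)

    module _ {o : Order} (⊆o : ∀ v {cs} → cs ⊆ o v cs) (r : Fin n) where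

      -- Each level uses up one unit of the height bound, so below `length ps` ancestors exactly `d`
      -- of the initial `n` units remain.
      Trail⇒subtree : ∀ d v ps → Trail (v ∷ ps) → end v ps ≡ r → d + length ps ≡ n →
                      planeFrom o t d (head ps) v ∈ᵀ planeFrom o t n nothing r
      Trail⇒subtree d v []       tr refl eq =
        subst (λ k → planeFrom o t d nothing v ∈ᵀ planeFrom o t k nothing v) (trans (sym (+-identityʳ d)) eq) here
      Trail⇒subtree d v (p ∷ ps) tr e    eq =
        child∈ᵀ (Trail⇒subtree (suc d) p ps (Trail-tail tr) e (trans (sym (+-suc d _)) eq))
          (∈-map⁺ (planeFrom o t d (just p)) (⊆o p (child-Trail ps tr)))

      Trail⇒ParentOf : ∀ v c ps → Trail (c ∷ v ∷ ps) → end v ps ≡ r →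
                       ParentOf (planeFrom o t n nothing r) v c
      Trail⇒ParentOf v c ps tr e =
        _ , Trail⇒subtree (suc d) v ps (Trail-tail tr) e (trans (sym (+-suc d _)) (m∸n+n≡m len)) ,
        subst (c ∈_) (sym (roots-planeFrom o t d (just v) _)) (⊆o v (child-Trail ps tr))
        where
        len : suc (length ps) ≤ n
        len = <⇒≤ (Unique⇒length≤ (tree-Trail⇒Unique tr))
        -- The bound left at `v` must be a successor, or its children would be cut off. The
        -- `length ps + 2` distinct vertices of the trail guarantee this.
        d = n ∸ suc (length ps)

      planeFrom-complete : ∀ v → v ∈ pw (planeFrom o t n nothing r)
      planeFrom-complete v =
        let ps , tr , e = Star⇒Trail Fin._≟_ (connected v r)
            len = ≤-trans (n≤1+n _) (Unique⇒length≤ (tree-Trail⇒Unique tr))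
            d = n ∸ length ps
        in ∈ᵀ⇒pw⊆ (Trail⇒subtree d v ps tr e (m∸n+n≡m len))
             (subst (_∈ pw (planeFrom o t d (head ps) v)) (root-planeFrom o t d (head ps) v)
               (root∈pw (planeFrom o t d (head ps) v)))

      -- On the trail from `v` to the root, `w` is either the next vertex, hence the parent of `v`,
      -- or it prolongs the trail backwards and is a child.
      Adj⇒ParentOf : ∀ {v w} → Adj v w →
                     ParentOf (planeFrom o t n nothing r) v w ⊎ ParentOf (planeFrom o t n nothing r) w v
      Adj⇒ParentOf {v} {w} a with Star⇒Trail Fin._≟_ (connected v r)
      ... | []     , tr , e = inj₁ (Trail⇒ParentOf v w [] [ Adj-sym a ] e)
      ... | p ∷ ps , tr , e with w Fin.≟ p
      ...   | yes refl = inj₂ (Trail⇒ParentOf w v ps tr e)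
      ...   | no w≢p   = inj₁ (Trail⇒ParentOf v w (p ∷ ps) (Adj-sym a ∷⟨ w≢p ⟩ tr) e)

T-does⁻ : {P : Set} (P? : Dec P) → T (does P?) → P
T-does⁻ (yes p) _ = p

T-does⁺ : {P : Set} (P? : Dec P) → P → T (does P?)
T-does⁺ (yes _) _ = tt
T-does⁺ (no ¬p) p = ¬p p

-- A trail that goes down once goes down ever after, because it cannot return
-- to the unique parent it came from.
module _ {V : Set} (E : V → V → Set) (parent! : ∀ {a b c} → E a c → E b c → a ≡ b)
         (rank : V → ℕ) (E⇒< : ∀ {a b} → E a b → rank b < rank a) where

  private
    Adj : V → V → Set
    Adj a b = E a b ⊎ E b a

  open Trails Adj

  private
    -- Keeps hold of the last step of a walk, the one from `p` to `e`.
    data EndsIn (p e : V) : V → List V → Set where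
      stop : EndsIn p e p (e ∷ [])
      skip : ∀ {x y ys} → EndsIn p e y ys → EndsIn p e x (y ∷ ys)

    down : ∀ {a b} zs → Trail (a ∷ b ∷ zs) → E a b → rank (end b zs) < rank a
    down []       _                         ab = E⇒< ab
    down (z ∷ zs) (_ ∷⟨ a≢z ⟩ tr) ab with Trail-head tr
    ... | inj₁ bz = <-trans (down zs tr bz) (E⇒< ab)
    ... | inj₂ zb = contradiction (parent! ab zb) a≢z

    -- If the last step goes up, so does every earlier one: a step down followed by a step up would
    -- return to the same parent.
    up : ∀ {a b zs p e} → Trail (a ∷ b ∷ zs) → EndsIn p e a (b ∷ zs) → E p e ⊎ E b a × rank a < rank e
    up [ inj₁ ab ]        stop     = inj₁ ab
    up [ inj₂ ba ]        stop     = inj₂ (ba , E⇒< ba)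
    up [ _ ]              (skip ())
    up (adj ∷⟨ a≢c ⟩ tr) (skip en) with up tr en | adj
    ... | inj₁ pe       | _       = inj₁ pe
    ... | inj₂ (cb , _) | inj₁ ab = contradiction (parent! ab cb) a≢c
    ... | inj₂ (_ , <e) | inj₂ ba = inj₂ (ba , <-trans (E⇒< ba) <e)

    end-∷ʳ : ∀ x xs v → end x (xs ∷ʳ v) ≡ v
    end-∷ʳ x []       v = refl
    end-∷ʳ x (y ∷ xs) v = end-∷ʳ y xs v

    endsIn : ∀ x y zs v → ∃ λ p → p ∈ y ∷ zs × EndsIn p v x (y ∷ zs ∷ʳ v)
    endsIn x y []       v = y , here refl , skip stop
    endsIn x y (z ∷ zs) v = let p , p∈ , en = endsIn y z zs v in p , there p∈ , skip en

    Linked⇒Trail : ∀ x xs {v} → Unique (x ∷ xs) → v ∉ x ∷ xs → Linked Adj (x ∷ xs ∷ʳ v) →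
                   Trail (x ∷ xs ∷ʳ v)
    Linked⇒Trail x []           _                    _  (a ∷ _) = [ a ]
    Linked⇒Trail x (y ∷ [])     (_ ∷ xs!)           v∉ (a ∷ l) =
      a ∷⟨ v∉ ∘ here ∘ sym ⟩ Linked⇒Trail y [] xs! (v∉ ∘ there) l
    Linked⇒Trail x (y ∷ z ∷ zs) ((_ ∷ x≢z ∷ _) ∷ xs!) v∉ (a ∷ l) =
      a ∷⟨ x≢z ⟩ Linked⇒Trail y (z ∷ zs) xs! (v∉ ∘ there) l

  -- A cycle leaving `v` downwards sinks in rank all the way back to `v`. One leaving upwards and
  -- returning upwards has `x` both above and below `v` in rank. One leaving upwards and returning
  -- downwards enters `v` from its only parent `x`, which would then occur twice.
  forest-acyclic : ∀ v ws → 2 ≤ length ws → Unique (v ∷ ws) → ¬ Linked Adj (v ∷ ws ∷ʳ v)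
  forest-acyclic v (x ∷ [])     (s≤s ())
  forest-acyclic v (x ∷ y ∷ zs) _ (v∉@(_ ∷ v≢y ∷ _) ∷ ws!@(x∉ ∷ _)) (a ∷ l)
    with p , p∈ , en ← endsIn x y zs v
    with tr ← Linked⇒Trail x (y ∷ zs) ws! (All.All¬⇒¬Any v∉) l
    with up tr en | a
  ... | _               | inj₁ vx = <-irrefl (cong rank (end-∷ʳ y zs v)) (down _ (inj₁ vx ∷⟨ v≢y ⟩ tr) vx)
  ... | inj₁ pv         | inj₂ xv = contradiction (parent! xv pv) (All.lookup x∉ p∈)
  ... | inj₂ (_ , x<v)  | inj₂ xv = <-irrefl refl (<-trans x<v (E⇒< xv))

-- The tree with a given plane tree

module FromPlane {n : ℕ} (P : PlaneTree (Fin n)) (P! : Unique (pw P)) (P∋ : ∀ v → v ∈ pw P) where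

  open import Data.List.Membership.DecPropositional (Fin._≟_ {n}) using (_∈?_)

  private
    forestAt : Fin n → List (PlaneTree (Fin n))
    forestAt v = proj₁ (subtreeAt P (P∋ v))

    forestAt∈ : ∀ v → node v (forestAt v) ∈ᵀ P
    forestAt∈ v = proj₂ (subtreeAt P (P∋ v))

  ParentOf⇒child : ∀ {v w ts} → node v ts ∈ᵀ P → ParentOf P v w → w ∈ map root ts
  ParentOf⇒child p (us , q , w∈) = subst (λ xs → _ ∈ map root xs) (subtree-unique P! q p) w∈

  ParentOf? : ∀ v w → Dec (ParentOf P v w)
  ParentOf? v w = map′ (λ w∈ → _ , forestAt∈ v , w∈) (ParentOf⇒child (forestAt∈ v))
                       (w ∈? map root (forestAt v))

  Neighbours : Fin n → Fin n → Set
  Neighbours v w = ParentOf P v w ⊎ ParentOf P w v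

  Neighbours? : ∀ v w → Dec (Neighbours v w)
  Neighbours? v w = ParentOf? v w ⊎-dec ParentOf? w v

  rank : Fin n → ℕ
  rank v = length (pw (node v (forestAt v)))

  ParentOf⇒< : ∀ {v w} → ParentOf P v w → rank w < rank v
  ParentOf⇒< {v} {w} vw = child-smaller P! (forestAt∈ v) (forestAt∈ w) (ParentOf⇒child (forestAt∈ v) vw)

  mutual
    descend : ∀ s {x} → s ∈ᵀ P → x ∈ pw s → Star Neighbours (root s) x
    descend (node _ ts) p x∈ with ∈-pw⁻ ts x∈
    ... | inj₁ x∈ts = descendForest ts p id x∈ts
    ... | inj₂ refl = ε

    descendForest : ∀ us {v ts x} → node v ts ∈ᵀ P → us ⊆ ts → x ∈ pwForest us → Star Neighbours v x
    descendForest (u ∷ us) p us⊆ x∈ with ∈-++⁻ (pw u) x∈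
    ... | inj₁ x∈u  = inj₁ (_ , p , ∈-map⁺ root (us⊆ (here refl))) ◅
                      descend u (child∈ᵀ p (us⊆ (here refl))) x∈u
    ... | inj₂ x∈us = descendForest us p (us⊆ ∘ there) x∈us

  fromRoot : ∀ v → Star Neighbours (root P) v
  fromRoot v = descend P here (P∋ v)

  toTree : Tree n
  toTree = record
    { edge        = λ v w → does (Neighbours? v w)
    ; symmetric   = λ v w → does-⇔ (mk⇔ swap swap) (Neighbours? v w) (Neighbours? w v)
    ; irreflexive = λ v → irr ∘ T-does⁻ (Neighbours? v v)
    ; connected   = λ v w → Star.map (T-does⁺ (Neighbours? _ _))
                      (Star.reverse swap (fromRoot v) ◅◅ fromRoot w)
    ; acyclic     = λ v ws 2≤ ws! l →
                      forest-acyclic (ParentOf P) (parent-unique P!) rank ParentOf⇒< v ws 2≤ ws!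
                        (Linked.map (T-does⁻ (Neighbours? _ _)) l)
    }
    where
    irr : ∀ {v} → ¬ Neighbours v v
    irr (inj₁ vv) = <-irrefl refl (ParentOf⇒< vv)
    irr (inj₂ vv) = <-irrefl refl (ParentOf⇒< vv)

  -- Both directions matter: the first shows that a neighbour other than `p` is not above `v`, the
  -- second that no child of `v` is excluded as `p`.
  IsParent : Maybe (Fin n) → Fin n → Set
  IsParent p v = (∀ {u} → ParentOf P u v → just u ≡ p) × (∀ {u} → just u ≡ p → ParentOf P u v)

  root-IsParent : IsParent nothing (root P)
  root-IsParent = (λ p → contradiction p (root-not-child P!)) , λ ()

  child-IsParent : ∀ {v ts c} → node v ts ∈ᵀ P → c ∈ map root ts → IsParent (just v) c
  child-IsParent p c∈ = (λ q → cong just (parent-unique P! q (_ , p , c∈))) , λ { refl → _ , p , c∈ }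

  childrenOf⊆ : ∀ {p v ts} → node v ts ∈ᵀ P → IsParent p v → childrenOf toTree p v ⊆ map root ts
  childrenOf⊆ {v = v} q (par , _) {c} c∈ with ∈-childrenOf⁻ toTree c∈
  ... | a , c≢p with T-does⁻ (Neighbours? v c) a
  ...   | inj₁ vc = ParentOf⇒child q vc
  ...   | inj₂ cv = contradiction (par cv) c≢p

  ⊆childrenOf : ∀ {p v ts} → node v ts ∈ᵀ P → IsParent p v → map root ts ⊆ childrenOf toTree p v
  ⊆childrenOf {v = v} q (_ , par) {c} c∈ = ∈-childrenOf⁺ toTree
    (T-does⁺ (Neighbours? v c) (inj₁ (_ , q , c∈)))
    λ eq → <-irrefl refl (<-trans (ParentOf⇒< (_ , q , c∈)) (ParentOf⇒< (par eq)))

  -- Truncation at height `d` merely deletes subtrees, which `≼` allows. This carries the DID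
  -- conditions from the plane tree to the rooted graph.
  planeFrom-toTree-≼ : ∀ d {p s} → s ∈ᵀ P → IsParent p (root s) →
                       planeFrom (λ _ cs → cs) toTree d p (root s) ≼ s
  planeFrom-toTree-≼ zero    {s = node _ _}      q par = node []
  planeFrom-toTree-≼ (suc d) {p} {s = node v ts} q par = node (All.map⁺ (All.tabulate below))
    where
    below : ∀ {c} → c ∈ childrenOf toTree p v → Any (planeFrom (λ _ cs → cs) toTree d (just v) c ≼_) ts
    below c∈ with ∈-map⁻ root (childrenOf⊆ q par c∈)
    ... | s , s∈ , refl = lose s∈
      (planeFrom-toTree-≼ d (child∈ᵀ q s∈) (child-IsParent q (∈-map⁺ root s∈)))

  module _ {o : Order}
           (o≡ : ∀ {v ts cs} → node v ts ∈ᵀ P → AllPairs Fin._<_ cs →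
                 cs ⊆ map root ts → map root ts ⊆ cs → o v cs ≡ map root ts) where

    -- Word length stands in for height: it drops at each child, is never zero, and is at most `n`
    -- for the whole tree.
    planeFrom-toTree-≡ : ∀ d {p s} → length (pw s) ≤ d → s ∈ᵀ P → IsParent p (root s) →
                         planeFrom o toTree d p (root s) ≡ s
    planeFrom-toTree-≡ zero {s = s} len q par
      with () ← <-≤-trans (∈-length (root∈pw s)) len
    planeFrom-toTree-≡ (suc d) {p} {node v ts} len q par = cong (node v) (trans
      (cong (map (planeFrom o toTree d (just v)))
        (o≡ q (childrenOf-increasing toTree p v) (childrenOf⊆ q par) (⊆childrenOf q par)))
      (trans (sym (map-∘ ts)) (map-id-local (All.tabulate below))))
      where
      below : ∀ {s} → s ∈ ts → planeFrom o toTree d (just v) (root s) ≡ s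
      below s∈ = planeFrom-toTree-≡ d
        (≤-pred (≤-trans (length-pw-child s∈) len))
        (child∈ᵀ q s∈) (child-IsParent q (∈-map⁺ root s∈))

    planeFrom-toTree : planeFrom o toTree n nothing (root P) ≡ P
    planeFrom-toTree = planeFrom-toTree-≡ n (Unique⇒length≤ P!) here root-IsParent

-- Cyclic permutations

module _ {A : Set} where

  map-≡⇒≗ : ∀ {B : Set} {f g : A → B} xs → map f xs ≡ map g xs → ∀ {x} → x ∈ xs → f x ≡ g x
  map-≡⇒≗ (x ∷ xs) eq (here refl) = ∷-injectiveˡ eq
  map-≡⇒≗ (x ∷ xs) eq (there x∈)  = map-≡⇒≗ xs (∷-injectiveʳ eq) x∈

  module _ (E : Rel A 0ℓ) (f : A → A) where

    -- The equation says that `f` moves each letter to the next one, so consecutive pairs are the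
    -- pairs `a , f a`.
    Linked⇒All : ∀ x xs {y} → Linked E (x ∷ xs ∷ʳ y) → map f (x ∷ xs) ≡ xs ∷ʳ y →
                 All (λ a → E a (f a)) (x ∷ xs)
    Linked⇒All x []       (e ∷ _) refl = e ∷ []
    Linked⇒All x (z ∷ zs) (e ∷ l) eq with refl , eq′ ← ∷-injective eq = e ∷ Linked⇒All _ zs l eq′

    All⇒Linked : ∀ x xs {y} → All (λ a → E a (f a)) (x ∷ xs) → map f (x ∷ xs) ≡ xs ∷ʳ y →
                 Linked E (x ∷ xs ∷ʳ y)
    All⇒Linked x []       (e ∷ _)  refl = e ∷ [-]
    All⇒Linked x (z ∷ zs) (e ∷ es) eq with refl , eq′ ← ∷-injective eq = e ∷ All⇒Linked _ zs es eq′

  -- Both words follow the orbit of `x` under `f` and stop when it first reaches `z`.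
  orbit-unique : ∀ (f : A → A) {x z} us vs → map f (x ∷ us) ≡ us ∷ʳ z → map f (x ∷ vs) ≡ vs ∷ʳ z →
                 z ∉ us → z ∉ vs → us ≡ vs
  orbit-unique f []       []       _    _    _   _   = refl
  orbit-unique f []       (v ∷ vs) refl eq   _   z∉v = contradiction (here (∷-injectiveˡ eq)) z∉v
  orbit-unique f (u ∷ us) []       eq   refl z∉u _   = contradiction (here (∷-injectiveˡ eq)) z∉u
  orbit-unique f (u ∷ us) (v ∷ vs) eq   eq′  z∉u z∉v with ∷-injective eq | ∷-injective eq′
  ... | refl , eq₁ | refl , eq₂ = cong (u ∷_) (orbit-unique f us vs eq₁ eq₂ (z∉u ∘ there) (z∉v ∘ there))

module _ {n : ℕ} where

  -- A function given by its table of values; the default `z` is never reached when the first list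
  -- is complete and the lengths agree.
  matching : List (Fin n) → List (Fin n) → Fin n → Fin n
  matching (x ∷ xs) (y ∷ ys) z with z Fin.≟ x
  ... | yes _ = y
  ... | no  _ = matching xs ys z
  matching _ _ z = z

  map-matching : ∀ {xs ys} → Unique xs → length xs ≡ length ys → map (matching xs ys) xs ≡ ys
  map-matching {[]}     {[]}     _        _  = refl
  map-matching {x ∷ xs} {y ∷ ys} (x∉ ∷ !) eq = cong₂ _∷_ at-x
    (trans (map-cong-local (All.map off-x x∉)) (map-matching ! (suc-injective eq)))
    where
    at-x : matching (x ∷ xs) (y ∷ ys) x ≡ y
    at-x with x Fin.≟ x
    ... | yes _  = refl
    ... | no x≢x = contradiction refl x≢x
    off-x : ∀ {z} → x ≢ z → matching (x ∷ xs) (y ∷ ys) z ≡ matching xs ys z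
    off-x {z} x≢z with z Fin.≟ x
    ... | yes z≡x = contradiction (sym z≡x) x≢z
    ... | no  _   = refl

  matching-inverse : ∀ {xs ys} → Unique xs → Unique ys → length xs ≡ length ys →
                     ∀ {x} → x ∈ xs → matching ys xs (matching xs ys x) ≡ x
  matching-inverse {xs} {ys} xs! ys! eq = map-≡⇒≗ xs
    (trans (map-∘ xs) (trans (cong (map (matching ys xs)) (map-matching xs! eq))
      (trans (map-matching ys! (sym eq)) (sym (map-id xs)))))

  ∈-rotate : ∀ {x} {w : List (Fin n)} → x ∈ w → x ∈ rotate w
  ∈-rotate {w = _ ∷ ys} (here refl) = ∈-++⁺ʳ ys (here refl)
  ∈-rotate             (there x∈)  = ∈-++⁺ˡ x∈

  rotate-unique : ∀ {w : List (Fin n)} → Unique w → Unique (rotate w)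
  rotate-unique []       = []
  rotate-unique (x∉ ∷ !) = Unique.++⁺ ! ([] ∷ []) λ { (x∈ , here refl) → All.lookup x∉ x∈ refl }

  length-rotate : ∀ (w : List (Fin n)) → length w ≡ length (rotate w)
  length-rotate []       = refl
  length-rotate (x ∷ xs) = length-++-comm (x ∷ []) xs

  module _ (w : List (Fin n)) (w! : Unique w) (w∋ : ∀ v → v ∈ w) where

    cycle : Permutation′ n
    cycle = permutation (matching w (rotate w)) (matching (rotate w) w)
      (λ v → matching-inverse (rotate-unique w!) w! (sym (length-rotate w)) (∈-rotate (w∋ v)))
      (λ v → matching-inverse w! (rotate-unique w!) (length-rotate w) (w∋ v))

    cycle-isCycle : cycle IsCycle w
    cycle-isCycle = record
      { unique   = w!
      ; complete = w∋
      ; cyclic   = map-matching w! (length-rotate w)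
      }

  IsCycle-functional : ∀ {σ τ : Permutation′ n} {w} → σ IsCycle w → τ IsCycle w → σ Perm.≈ τ
  IsCycle-functional {w = w} p q v =
    map-≡⇒≗ w (trans (_IsCycle_.cyclic p) (sym (_IsCycle_.cyclic q))) (_IsCycle_.complete p v)

  IsCycle-rotate : ∀ {σ : Permutation′ n} x w → σ IsCycle (x ∷ w) → σ IsCycle (w ∷ʳ x)
  IsCycle-rotate {σ} x w p = record
    { unique   = rotate-unique unique
    ; complete = ∈-rotate ∘ complete
    ; cyclic   = trans (map-++ (σ ⟨$⟩ʳ_) w (x ∷ [])) (cong rotate cyclic)
    }
    where open _IsCycle_ p

  IsCycle-++-comm : ∀ {σ : Permutation′ n} us vs → σ IsCycle (us ++ vs) → σ IsCycle (vs ++ us)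
  IsCycle-++-comm {σ} []       vs p = subst (σ IsCycle_) (sym (++-identityʳ vs)) p
  IsCycle-++-comm {σ} (u ∷ us) vs p = subst (σ IsCycle_) (++-assoc vs (u ∷ []) us)
    (IsCycle-++-comm us (vs ∷ʳ u)
      (subst (σ IsCycle_) (++-assoc us vs (u ∷ [])) (IsCycle-rotate u (us ++ vs) p)))

  IsCycle-endingIn : ∀ {σ : Permutation′ n} {w} z → σ IsCycle w → ∃ λ us → σ IsCycle (us ∷ʳ z)
  IsCycle-endingIn {σ} z p with ∈-∃++ (_IsCycle_.complete p z)
  ... | us , vs , refl = vs ++ us , subst (σ IsCycle_) (sym (++-assoc vs us (z ∷ [])))
    (IsCycle-++-comm (us ∷ʳ z) vs (subst (σ IsCycle_) (sym (++-assoc us (z ∷ []) vs)) p))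

  IsCycle-unique : ∀ {σ τ : Permutation′ n} us vs {z} → σ Perm.≈ τ →
                   σ IsCycle (us ∷ʳ z) → τ IsCycle (vs ∷ʳ z) → us ≡ vs
  IsCycle-unique {σ} {τ} us vs {z} σ≈τ p q = orbit-unique (σ ⟨$⟩ʳ_) us vs (_IsCycle_.cyclic p′)
    (trans (map-cong σ≈τ (z ∷ vs)) (_IsCycle_.cyclic q′))
    (Unique.Unique[x∷xs]⇒x∉xs (_IsCycle_.unique p′)) (Unique.Unique[x∷xs]⇒x∉xs (_IsCycle_.unique q′))
    where
    p′ = IsCycle-++-comm us (z ∷ []) p
    q′ = IsCycle-++-comm vs (z ∷ []) q

  wordsUpTo : ℕ → List (List (Fin n))
  wordsUpTo zero    = [] ∷ []
  wordsUpTo (suc k) = [] ∷ cartesianProductWith _∷_ (allFin n) (wordsUpTo k)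

  ∈-wordsUpTo : ∀ k {w} → length w ≤ k → w ∈ wordsUpTo k
  ∈-wordsUpTo zero    {[]}    _         = here refl
  ∈-wordsUpTo (suc k) {[]}    _         = here refl
  ∈-wordsUpTo (suc k) {x ∷ w} (s≤s len) =
    there (∈-cartesianProductWith⁺ _∷_ (∈-allFin x) (∈-wordsUpTo k len))

-- Finite setoids

module _ (S : DecSetoid 0ℓ 0ℓ) where
  open DecSetoid S renaming (setoid to S′; refl to ≈-refl; sym to ≈-sym; trans to ≈-trans)

  IsEnumeration⇒HasCardinality : ∀ xs → IsEnumeration S′ xs → ∃ (HasCardinality S′)
  IsEnumeration⇒HasCardinality xs enum = length ys , record
    { to        = index
    ; from      = lookup ys
    ; to-cong   = λ x≈y → injective (≈-trans (≈-sym (index-correct _)) (≈-trans x≈y (index-correct _)))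
    ; from-cong = λ { refl → ≈-refl }
    ; inverse   = (λ x≈ → injective (≈-trans (≈-sym (index-correct _)) x≈))
                , (λ { refl → ≈-sym (index-correct _) })
    }
    where
    ys : List Carrier
    ys = deduplicate _≟_ xs
    ys∋ : IsEnumeration S′ ys
    ys∋ = deduplicate⁺ S enum
    index : Carrier → Fin (length ys)
    index x = Any.index (ys∋ x)
    index-correct : ∀ x → x ≈ lookup ys (index x)
    index-correct x = lookup-index (ys∋ x)
    injective : ∀ {i j} → lookup ys i ≈ lookup ys j → i ≡ j
    injective = AllPairs-lookup-injective ≈-sym (deduplicate-! S xs)

  -- One element is kept for every code that describes any. Since a code determines its element up
  -- to `≈`, every element is equivalent to a kept one.
  coded⇒HasCardinality : {W : Set} (Code : W → Carrier → Set) (code? : ∀ w → Dec (∃ (Code w))) →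
                         (∀ {w x y} → Code w x → Code w y → x ≈ y) →
                         ∀ ws → (∀ x → ∃ λ w → w ∈ ws × Code w x) → ∃ (HasCardinality S′)
  coded⇒HasCardinality {W} Code code? functional ws codes =
    IsEnumeration⇒HasCardinality (decoded ws) λ x → let w , w∈ , c = codes x in ∈-decoded w∈ c
    where
    open import Data.List.Membership.Setoid S′ using () renaming (_∈_ to _∈ₛ_)
    decoded : List W → List Carrier
    decoded []       = []
    decoded (w ∷ ws) with code? w
    ... | yes (x , _) = x ∷ decoded ws
    ... | no  _       = decoded ws
    ∈-decoded : ∀ {w x ws} → w ∈ ws → Code w x → x ∈ₛ decoded ws
    ∈-decoded {ws = w ∷ ws} w∈ c with code? w | w∈
    ... | yes (_ , c′) | here refl = here (functional c c′)
    ... | yes _        | there w∈′ = there (∈-decoded w∈′ c)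
    ... | no ¬c        | here refl = contradiction (_ , c) ¬c
    ... | no _         | there w∈′ = ∈-decoded w∈′ c

-- ℛ-DID trees and their words

module DID (A : FinitePositiveSet) (m : ℕ) where
  open FinitePositiveSet A

  V : Set
  V = Vertex A m

  E O R : V → Set
  E = EvenV A m
  O = OddV A m
  R = ℛ A m

  infix 4 _≺_
  _≺_ : V → V → Set
  a ≺ b = element a < element b

  private variable
    a b c v : V
    w us ws : List V
    ts      : List (PlaneTree V)

  ≺-connex : a ≢ b → a ≺ b ⊎ b ≺ a
  ≺-connex {a} {b} a≢b with Fin.<-cmp a b
  ... | tri< a<b _ _ = inj₁ (increasing a<b)
  ... | tri≈ _ a≡b _ = contradiction a≡b a≢b
  ... | tri> _ _ b<a = inj₂ (increasing b<a)

  zero-least : ∀ v → element zero ≤ element v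
  zero-least zero    = ≤-refl
  zero-least (suc v) = <⇒≤ (increasing (s≤s z≤n))

  -- Classes of vertices and sibling orders

  data Class (v : V) : Set where
    even  : E v → Class v
    odd-ℛ : R v → Class v
    odd   : O v → ¬ R v → Class v

  -- With the two decisions as arguments, `hatOrder-arrange` can split on them in step with the
  -- conditionals of `hatOrder`.
  classifyBy : Dec (E v) → Dec (R v) → Class v
  classifyBy (yes e) _        = even e
  classifyBy (no _)  (yes r)  = odd-ℛ r
  classifyBy (no o)  (no ¬r) = odd o ¬r

  classify : ∀ v → Class v
  classify v = classifyBy (even? A m v) (ℛ? A m v)

  -- Only even children follow those in ℛ, but descendants may also be odd and outside ℛ. All
  -- letters outside ℛ are treated alike, which keeps the order total.
  data ℛ-Before (a b : V) : Set where
    asc   : R a → R b → a ≺ b → ℛ-Before a b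
    first : R a → ¬ R b → ℛ-Before a b
    desc  : ¬ R a → ¬ R b → b ≺ a → ℛ-Before a b

  -- The order in which T̂ lists the children of a vertex of the given class,
  -- extended to all vertices.
  Before : Class v → V → V → Set
  Before (even _)  a b = a ≺ b
  Before (odd-ℛ _) a b = ℛ-Before a b
  Before (odd _ _) a b = b ≺ a

  Before-asym : (k : Class v) → Before k a b → ¬ Before k b a
  Before-asym (even _)  p             q             = <-asym p q
  Before-asym (odd _ _) p             q             = <-asym p q
  Before-asym (odd-ℛ _) (asc _ _ p)   (asc _ _ q)   = <-asym p q
  Before-asym (odd-ℛ _) (asc r _ _)   (first _ ¬r) = ¬r r
  Before-asym (odd-ℛ _) (asc r _ _)   (desc _ ¬r _) = ¬r r
  Before-asym (odd-ℛ _) (first _ ¬r)  (asc r _ _)   = ¬r r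
  Before-asym (odd-ℛ _) (first _ ¬r)  (first r _)   = ¬r r
  Before-asym (odd-ℛ _) (first r _)   (desc _ ¬r _) = ¬r r
  Before-asym (odd-ℛ _) (desc ¬r _ _) (asc _ r _)   = ¬r r
  Before-asym (odd-ℛ _) (desc _ ¬r _) (first r _)   = ¬r r
  Before-asym (odd-ℛ _) (desc _ _ p)  (desc _ _ q)  = <-asym p q

  Before-trans : (k : Class v) → Before k a b → Before k b c → Before k a c
  Before-trans (even _)  p             q             = <-trans p q
  Before-trans (odd _ _) p             q             = <-trans q p
  Before-trans (odd-ℛ _) (asc r _ p)   (asc _ r′ q)  = asc r r′ (<-trans p q)
  Before-trans (odd-ℛ _) (asc r _ _)   (first _ ¬r) = first r ¬r
  Before-trans (odd-ℛ _) (asc _ r _)   (desc ¬r _ _) = contradiction r ¬r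
  Before-trans (odd-ℛ _) (first _ ¬r)  (asc r _ _)   = contradiction r ¬r
  Before-trans (odd-ℛ _) (first _ ¬r)  (first r _)   = contradiction r ¬r
  Before-trans (odd-ℛ _) (first r _)   (desc _ ¬r _) = first r ¬r
  Before-trans (odd-ℛ _) (desc _ ¬r _) (asc r _ _)   = contradiction r ¬r
  Before-trans (odd-ℛ _) (desc _ ¬r _) (first r _)   = contradiction r ¬r
  Before-trans (odd-ℛ _) (desc ¬r _ p) (desc _ ¬r′ q) = desc ¬r ¬r′ (<-trans q p)

  Before-connex : (k : Class v) → a ≢ b → Before k a b ⊎ Before k b a
  Before-connex (even _)  a≢b = ≺-connex a≢b
  Before-connex (odd _ _) a≢b = ≺-connex (≢-sym a≢b)
  Before-connex {a = a} {b = b} (odd-ℛ _) a≢b with ℛ? A m a | ℛ? A m b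
  ... | yes r | yes r′  = Sum.map (asc r r′) (asc r′ r) (≺-connex a≢b)
  ... | yes r | no ¬r   = inj₁ (first r ¬r)
  ... | no ¬r | yes r   = inj₂ (first r ¬r)
  ... | no ¬r | no ¬r′  = Sum.map (desc ¬r ¬r′) (desc ¬r′ ¬r) (≺-connex (≢-sym a≢b))

  Precedes : V → V → V → Set
  Precedes v = Before (classify v)

  Admissible : Class v → V → Set
  Admissible (even _)  c = O c × ¬ R c
  Admissible (odd-ℛ _) c = E c ⊎ O c × R c
  Admissible (odd _ _) c = E c

  Bound : V → V → Set
  Bound v d = (O v → v ≺ d) × (E v → d ≺ v)

  module _ {cs ds : List V} where

    DIDCondition⇒Admissible : (k : Class v) → DIDCondition A m v cs ds → All (Admissible k) cs
    DIDCondition⇒Admissible (even e)    d = proj₂ (DIDCondition.even d e)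
    DIDCondition⇒Admissible (odd-ℛ r)   d = proj₂ (DIDCondition.odd-ℛ d (proj₁ r) r)
    DIDCondition⇒Admissible (odd o ¬r) d = proj₂ (DIDCondition.odd-¬ℛ d o ¬r)

    DIDCondition⇒Bound : Class v → DIDCondition A m v cs ds → All (Bound v) ds
    DIDCondition⇒Bound (even e)  d =
      All.map (λ p → (λ o → contradiction e o) , λ _ → p) (proj₁ (DIDCondition.even d e))
    DIDCondition⇒Bound (odd-ℛ r) d =
      All.map (λ p → (λ _ → p) , λ e → contradiction e (proj₁ r)) (proj₁ (DIDCondition.odd-ℛ d (proj₁ r) r))
    DIDCondition⇒Bound (odd o ¬r) d =
      All.map (λ p → (λ _ → p) , λ e → contradiction e o) (proj₁ (DIDCondition.odd-¬ℛ d o ¬r))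

    mkDIDCondition : (k : Class v) → All (Admissible k) cs → All (Bound v) ds → DIDCondition A m v cs ds
    mkDIDCondition (even e) adm bd = record
      { odd-ℛ  = λ o → contradiction e o
      ; odd-¬ℛ = λ o → contradiction e o
      ; even   = λ e → All.map (λ p → proj₂ p e) bd , adm
      }
    mkDIDCondition (odd-ℛ r) adm bd = record
      { odd-ℛ  = λ o _ → All.map (λ p → proj₁ p o) bd , adm
      ; odd-¬ℛ = λ _ ¬r → contradiction r ¬r
      ; even   = λ e → contradiction e (proj₁ r)
      }
    mkDIDCondition (odd o ¬r) adm bd = record
      { odd-ℛ  = λ _ r → contradiction r ¬r
      ; odd-¬ℛ = λ o _ → All.map (λ p → proj₁ p o) bd , adm
      ; even   = λ e → contradiction e o
      }

  admissible : IsDID A m (node v ts) → All (Admissible (classify v)) (map root ts)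
  admissible (node d _) = DIDCondition⇒Admissible (classify _) d

  bounded : IsDID A m (node v ts) → All (Bound v) (pwForest ts)
  bounded (node d _) = DIDCondition⇒Bound (classify _) d

  mutual
    -- The DID conditions quantify universally over children and descendants, and `≼` can only
    -- shrink both sets.
    IsDID-≼ : ∀ {s t} → s ≼ t → IsDID A m t → IsDID A m s
    IsDID-≼ (node {v = v} ps) (node d ds) = node
      (mkDIDCondition (classify v)
        (All.anti-mono (≼⇒roots⊆ ps) (DIDCondition⇒Admissible (classify v) d))
        (All.anti-mono (≼⇒pwForest⊆ ps) (DIDCondition⇒Bound (classify v) d)))
      (IsDID-≼Forest ps ds)

    IsDID-≼Forest : ∀ {ts us} → All (λ t → Any (t ≼_) us) ts → All (IsDID A m) us → All (IsDID A m) ts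
    IsDID-≼Forest []       ds = []
    IsDID-≼Forest (p ∷ ps) ds = IsDID-≼Any p ds ∷ IsDID-≼Forest ps ds

    IsDID-≼Any : ∀ {t us} → Any (t ≼_) us → All (IsDID A m) us → IsDID A m t
    IsDID-≼Any (here p)  (d ∷ _)  = IsDID-≼ p d
    IsDID-≼Any (there p) (_ ∷ ds) = IsDID-≼Any p ds

  mutual
    IsDID-subtree : ∀ {s t} → s ∈ᵀ t → IsDID A m t → IsDID A m s
    IsDID-subtree here      d          = d
    IsDID-subtree (there p) (node _ ds) = IsDID-subtreeForest p ds

    IsDID-subtreeForest : ∀ {s ts} → Any (s ∈ᵀ_) ts → All (IsDID A m) ts → IsDID A m s
    IsDID-subtreeForest (here p)  (d ∷ _)  = IsDID-subtree p d
    IsDID-subtreeForest (there p) (_ ∷ ds) = IsDID-subtreeForest p ds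

  -- Arranging the children of a vertex

  arrange : Class v → List V → List V
  arrange (even _)  cs = cs
  arrange (odd-ℛ _) cs = filter (ℛ? A m) cs ++ reverse (filter (even? A m) cs)
  arrange (odd _ _) cs = reverse cs

  hatOrder-arrange : ∀ v cs → hatOrder A m v cs ≡ arrange (classify v) cs
  hatOrder-arrange v cs = go (even? A m v) (ℛ? A m v)
    where
    go : (e? : Dec (E v)) (r? : Dec (R v)) →
         (if does e? then cs
          else if does r? then filter (ℛ? A m) cs ++ reverse (filter (even? A m) cs)
          else reverse cs)
         ≡ arrange (classifyBy e? r?) cs
    go (yes _) _       = refl
    go (no _)  (yes _) = refl
    go (no _)  (no _)  = refl

  module _ {cs : List V} where

    arrange-sorted : (k : Class v) → AllPairs Fin._<_ cs → AllPairs (Before k) (arrange k cs)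
    arrange-sorted (even _)  cs< = AllPairs.map increasing cs<
    arrange-sorted (odd _ _) cs< = AllPairs-reverse (AllPairs.map increasing cs<)
    arrange-sorted (odd-ℛ _) cs< = AllPairs.++⁺ rs es
      (All.map (λ r → All.anti-mono (Any.reverse⁻ {xs = filter (even? A m) cs})
                        (All.map (λ e → first r (λ r′ → proj₁ r′ e)) (All.all-filter (even? A m) cs)))
        (All.all-filter (ℛ? A m) cs))
      where
      both : ∀ {P : V → Set} {Q S : V → V → Set} → (∀ {a b} → P a → P b → Q a b → S a b) →
             ∀ {xs} → All P xs → AllPairs Q xs → AllPairs S xs
      both f []       []       = []
      both f (p ∷ ps) (q ∷ qs) = All.zipWith (λ (p′ , q′) → f p p′ q′) (ps , q) ∷ both f ps qs
      rs : AllPairs ℛ-Before (filter (ℛ? A m) cs)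
      rs = both (λ r r′ i<j → asc r r′ (increasing i<j)) (All.all-filter (ℛ? A m) cs)
             (AllPairs.filter⁺ (ℛ? A m) cs<)
      es : AllPairs ℛ-Before (reverse (filter (even? A m) cs))
      es = AllPairs-reverse (both (λ e e′ i<j → desc (λ r → proj₁ r e′) (λ r → proj₁ r e) (increasing i<j))
             (All.all-filter (even? A m) cs) (AllPairs.filter⁺ (even? A m) cs<))

    arrange⊆ : (k : Class v) → arrange k cs ⊆ cs
    arrange⊆ (even _)  c∈ = c∈
    arrange⊆ (odd _ _) c∈ = Any.reverse⁻ c∈
    arrange⊆ (odd-ℛ _) c∈ with ∈-++⁻ (filter (ℛ? A m) cs) c∈
    ... | inj₁ c∈′ = proj₁ (∈-filter⁻ (ℛ? A m) c∈′)
    ... | inj₂ c∈′ = proj₁ (∈-filter⁻ (even? A m) {xs = cs} (Any.reverse⁻ c∈′))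

    -- Below a vertex in ℛ the two filters lose exactly the odd vertices outside ℛ, which are not
    -- admissible there.
    ⊆arrange : (k : Class v) → All (Admissible k) cs → cs ⊆ arrange k cs
    ⊆arrange (even _)  adm c∈ = c∈
    ⊆arrange (odd _ _) adm c∈ = Any.reverse⁺ c∈
    ⊆arrange (odd-ℛ _) adm c∈ with All.lookup adm c∈
    ... | inj₁ e       = ∈-++⁺ʳ (filter (ℛ? A m) cs) (Any.reverse⁺ (∈-filter⁺ (even? A m) c∈ e))
    ... | inj₂ (_ , r) = ∈-++⁺ˡ (∈-filter⁺ (ℛ? A m) c∈ r)

    hatOrder-sorted : ∀ v → AllPairs Fin._<_ cs → AllPairs (Precedes v) (hatOrder A m v cs)
    hatOrder-sorted v cs< = subst (AllPairs _) (sym (hatOrder-arrange v cs)) (arrange-sorted (classify v) cs<)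

    hatOrder⊆ : ∀ v → hatOrder A m v cs ⊆ cs
    hatOrder⊆ v c∈ = arrange⊆ (classify v) (subst (_ ∈_) (hatOrder-arrange v cs) c∈)

    ⊆hatOrder : ∀ v → All (Admissible (classify v)) cs → cs ⊆ hatOrder A m v cs
    ⊆hatOrder v adm c∈ = subst (_ ∈_) (sym (hatOrder-arrange v cs)) (⊆arrange (classify v) adm c∈)

    hatOrder-unique : ∀ v → AllPairs Fin._<_ cs → Unique (hatOrder A m v cs)
    hatOrder-unique v cs< =
      AllPairs.map (λ { p refl → Before-asym (classify v) p p }) (hatOrder-sorted v cs<)

  -- Each root comes first, in the sibling order below v, among all letters from
  -- its own subtree onwards; so it can be recognised in the postorder word.
  data Canonical (v : V) : List (PlaneTree V) → Set where
    []   : Canonical v []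
    cons : ∀ {c us ts} → All (Precedes v c) (pwForest us) → All (Precedes v c) (pwForest ts) →
           Canonical c us → Canonical v ts → Canonical v (node c us ∷ ts)

  pwForest-node : ∀ c (us ts : List (PlaneTree V)) →
                  pwForest (node c us ∷ ts) ≡ pwForest us ++ c ∷ pwForest ts
  pwForest-node c us ts = ∷ʳ-++ (pwForest us) c (pwForest ts)

  Canonical-unique : ∀ {us} → Unique (pwForest ts) → Canonical v ts → Canonical v us →
                     pwForest ts ≡ pwForest us → ts ≡ us
  Canonical-unique _ [] [] _ = refl
  Canonical-unique _ [] (cons {c} {us} {ts} _ _ _ _) eq
    with () ← subst (c ∈_) (sym (trans eq (pwForest-node c us ts))) (∈-++⁺ʳ (pwForest us) (here refl))
  Canonical-unique _ (cons {c} {us} {ts} _ _ _ _) [] eq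
    with () ← subst (c ∈_) (trans (sym (pwForest-node c us ts)) eq) (∈-++⁺ʳ (pwForest us) (here refl))
  Canonical-unique {v = v} !
    (cons {c} {as} {ts} c<as c<ts Cas Cts) (cons {c′} {bs} {us} c′<bs c′<us Cbs Cus) eq
    with same-first
    where
    eq′ : pwForest as ++ c ∷ pwForest ts ≡ pwForest bs ++ c′ ∷ pwForest us
    eq′ = trans (sym (pwForest-node c as ts)) (trans eq (pwForest-node c′ bs us))
    leads : ∀ {x y xs ys} → All (Precedes v x) xs → All (Precedes v x) ys → y ∈ xs ++ x ∷ ys →
            x ≡ y ⊎ Precedes v x y
    leads {xs = xs} p q y∈ with ∈-++⁻ xs y∈
    ... | inj₁ y∈xs         = inj₂ (All.lookup p y∈xs)
    ... | inj₂ (here refl)  = inj₁ refl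
    ... | inj₂ (there y∈ys) = inj₂ (All.lookup q y∈ys)
    same-first : c ≡ c′
    same-first with leads c<as c<ts (subst (c′ ∈_) (sym eq′) (∈-++⁺ʳ (pwForest bs) (here refl)))
                  | leads c′<bs c′<us (subst (c ∈_) eq′ (∈-++⁺ʳ (pwForest as) (here refl)))
    ... | inj₁ c≡c′ | _         = c≡c′
    ... | inj₂ _    | inj₁ c′≡c = sym c′≡c
    ... | inj₂ p    | inj₂ q    = contradiction q (Before-asym (classify v) p)
  ... | refl =
    let !′         = subst Unique (pwForest-node c as ts) !
        as≡ , ts≡  = Unique-split (pwForest as) (pwForest bs) !′
                       (trans (sym (pwForest-node c as ts)) (trans eq (pwForest-node c bs us)))
        !as , !cts , _ = AllPairs-++⁻ (pwForest as) !′
    in cong₂ (λ xs ys → node c xs ∷ ys)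
         (Canonical-unique !as Cas Cbs as≡) (Canonical-unique (AllPairs.tail !cts) Cts Cus ts≡)

  Canonical-roots : ∀ {ts} → Canonical v ts → AllPairs (Precedes v) (map root ts)
  Canonical-roots []                          = []
  Canonical-roots (cons {ts = ts} _ c<ts _ C) = All.anti-mono (roots⊆pwForest ts) c<ts ∷ Canonical-roots C

  Canonical-subtree : ∀ {fs c us} → Any (node c us ∈ᵀ_) fs → Canonical v fs → Canonical c us
  Canonical-subtree (here here)      (cons _ _ C _) = C
  Canonical-subtree (here (there p)) (cons _ _ C _) = Canonical-subtree p C
  Canonical-subtree (there p)        (cons _ _ _ C) = Canonical-subtree p C

  Admissible⇒¬ℛ : (k : Class v) → ¬ R v → Admissible k c → ¬ R c
  Admissible⇒¬ℛ (even _)  _  (_ , ¬r) = ¬r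
  Admissible⇒¬ℛ (odd-ℛ r) ¬r _        = contradiction r ¬r
  Admissible⇒¬ℛ (odd _ _) _  e        = λ r → proj₁ r e

  mutual
    -- Only vertices in ℛ admit children in ℛ, so a downward path that has left ℛ never re-enters
    -- it.
    descendants-¬ℛ : ∀ {ts} → IsDID A m (node v ts) → ¬ R v → All (¬_ ∘ R) (pwForest ts)
    descendants-¬ℛ {v = v} did@(node _ ds) ¬r =
      pwForest-¬ℛ ds (All.map (Admissible⇒¬ℛ (classify v) ¬r) (admissible did))

    pwForest-¬ℛ : ∀ {ts} → All (IsDID A m) ts → All (¬_ ∘ R) (map root ts) → All (¬_ ∘ R) (pwForest ts)
    pwForest-¬ℛ {[]}            []       []         = []
    pwForest-¬ℛ {node _ _ ∷ ts} (d ∷ ds) (¬r ∷ ¬rs) =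
      All.++⁺ (All.∷ʳ⁺ (descendants-¬ℛ d ¬r) ¬r) (pwForest-¬ℛ ds ¬rs)

  -- In each case the bound of `c` on its descendants points along the order below `v`. Under a
  -- parent in ℛ, an even `c` has only smaller descendants outside ℛ, while for `c` in ℛ the larger
  -- descendants follow whether or not they belong to ℛ.
  child-precedes : ∀ {us} (k : Class v) → Admissible k c → IsDID A m (node c us) →
                   All (Before k c) (pwForest us)
  child-precedes (even _)  (o , _) did = All.map (λ p → proj₁ p o) (bounded did)
  child-precedes (odd _ _) e       did = All.map (λ p → proj₂ p e) (bounded did)
  child-precedes (odd-ℛ _) (inj₁ e) did = All.zipWith
    (λ (p , ¬r) → desc (λ r → proj₁ r e) ¬r (proj₂ p e))
    (bounded did , descendants-¬ℛ did (λ r → proj₁ r e))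
  child-precedes {c = c} (odd-ℛ _) (inj₂ (o , r)) did = All.map (λ p → split (proj₁ p o)) (bounded did)
    where
    split : ∀ {d} → c ≺ d → ℛ-Before c d
    split {d} c≺d with ℛ? A m d
    ... | yes r′ = asc r r′ c≺d
    ... | no ¬r′ = first r ¬r′

  precedes-pwForest : ∀ {ts} → All (IsDID A m) ts → All (Admissible (classify v)) (map root ts) →
                      All (Precedes v c) (map root ts) → All (Precedes v c) (pwForest ts)
  precedes-pwForest {ts = []} [] [] [] = []
  precedes-pwForest {v = v} {ts = node _ _ ∷ ts} (d ∷ ds) (adm ∷ adms) (p ∷ ps) = All.++⁺
    (All.∷ʳ⁺ (All.map (Before-trans (classify v) p) (child-precedes (classify v) adm d)) p)
    (precedes-pwForest ds adms ps)

  mkCanonical : ∀ {ts} → All (IsDID A m) ts → All (Admissible (classify v)) (map root ts) →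
                AllPairs (Precedes v) (map root ts) →
                All (λ t → Canonical (root t) (children t)) ts → Canonical v ts
  mkCanonical {ts = []} [] [] [] [] = []
  mkCanonical {v = v} {ts = node _ _ ∷ ts} (d ∷ ds) (adm ∷ adms) (p ∷ ps) (C ∷ Cs) =
    cons (child-precedes (classify v) adm d) (precedes-pwForest ds adms p) C (mkCanonical ds adms ps Cs)

  -- What an ℛ-D-permutation demands of σ(a) = b ≠ a.
  Step : V → V → Set
  Step a b = (O a → ¬ R a → a ≺ b) × (E a → b ≺ a)

  -- In the word a child `a` of `v` is followed by a letter of the next sibling's subtree, or by `v`
  -- itself; the latter case is `Bound⇒Step`. For `a` in ℛ nothing is demanded.
  Before⇒Step : (k : Class v) → Admissible k a → Before k a b → Step a b
  Before⇒Step (even _)  (o , _)        p            = (λ _ _ → p) , λ e → contradiction e o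
  Before⇒Step (odd _ _) e              p            = (λ o → contradiction e o) , λ _ → p
  Before⇒Step (odd-ℛ _) (inj₂ (o , r)) p            = (λ _ ¬r → contradiction r ¬r) , λ e → contradiction e o
  Before⇒Step (odd-ℛ _) (inj₁ e)       (asc r _ _)  = contradiction e (proj₁ r)
  Before⇒Step (odd-ℛ _) (inj₁ e)       (first r _)  = contradiction e (proj₁ r)
  Before⇒Step (odd-ℛ _) (inj₁ e)       (desc _ _ p) = (λ o → contradiction e o) , λ _ → p

  Bound⇒Step : (k : Class v) → Admissible k a → Bound v a → Step a v
  Bound⇒Step (even e)  (o , _)        p = (λ _ _ → proj₂ p e) , λ e → contradiction e o
  Bound⇒Step (odd o _) e              p = (λ o → contradiction e o) , λ _ → proj₁ p o
  Bound⇒Step (odd-ℛ r) (inj₁ e)       p = (λ o → contradiction e o) , λ _ → proj₁ p (proj₁ r)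
  Bound⇒Step (odd-ℛ _) (inj₂ (o , r)) p = (λ _ ¬r → contradiction r ¬r) , λ e → contradiction e o

  mutual
    Canonical⇒Linked : ∀ {ts} → IsDID A m (node v ts) → Canonical v ts → Linked Step (pwForest ts ∷ʳ v)
    Canonical⇒Linked did@(node _ ds) C = Canonical⇒LinkedForest ds (admissible did) (bounded did) C

    Canonical⇒LinkedForest : ∀ {ts} → All (IsDID A m) ts → All (Admissible (classify v)) (map root ts) →
                             All (Bound v) (pwForest ts) → Canonical v ts →
                             Linked Step (pwForest ts ∷ʳ v)
    Canonical⇒LinkedForest [] [] _ [] = [-]
    Canonical⇒LinkedForest {v = v} (d ∷ ds) (adm ∷ adms) bd (cons {c} {us} {ts} _ c<ts C Cs) =
      subst (Linked Step) (sym (trans (cong (_∷ʳ v) (pwForest-node c us ts)) (++-assoc (pwForest us) _ _)))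
        (Linked-++⁺ (pwForest us) (Canonical⇒Linked d C)
          -- `Step c` holds for every later letter including `v`, so whether `c` is the last child
          -- makes no difference.
          (prepend (pwForest ts ∷ʳ v)
            (All.∷ʳ⁺ (All.map (Before⇒Step (classify v) adm) c<ts)
                     (Bound⇒Step (classify v) adm (All.lookup bd (∈-++⁺ˡ (∈-++⁺ʳ (pwForest us) (here refl))))))
            (Canonical⇒LinkedForest ds adms (All.++⁻ʳ (pw (node c us)) bd) Cs)))
      where
      prepend : ∀ {c} xs → All (Step c) xs → Linked Step xs → Linked Step (c ∷ xs)
      prepend []       _       _ = [-]
      prepend (_ ∷ _)  (p ∷ _) l = p ∷ l

  -- Decoding words into forests

  -- The invariant of the recursion: `linked` comes from the permutation, while `bound` and `no-ℛ`
  -- hold for the descendants of `v` in any DID tree.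
  record Decodable (v : V) (w : List V) : Set where
    field
      linked : Linked Step (w ∷ʳ v)
      bound  : All (Bound v) w
      no-ℛ   : ¬ R v → All (¬_ ∘ R) w

  record Decoding (v : V) (w : List V) : Set where
    field
      forest     : List (PlaneTree V)
      word       : pwForest forest ≡ w
      admits     : All (Admissible (classify v)) (map root forest)
      isDIDs     : All (IsDID A m) forest
      canonical  : Canonical v forest

  -- Produces the letter after `c`, which is the first of `ws` or else `v`, together with a property
  -- common to both.
  next : ∀ {Q : V → Set} → Linked Step (c ∷ ws ∷ʳ v) → All Q ws → Q v → ∃ λ b → Step c b × Q b
  next {ws = []}    (s ∷ _) []      q = _ , s , q
  next {ws = b ∷ _} (s ∷ _) (q ∷ _) _ = b , s , q

  -- An even letter is followed by a smaller one, so its bound is inherited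
  -- from the next odd letter or from the final c.
  odds-above : Linked Step (us ∷ʳ c) → All (λ d → O d → c ≺ d) us → All (c ≺_) us
  odds-above {us = []} _ [] = []
  odds-above {us = d ∷ us} {c} l (p ∷ ps) with even? A m d | odds-above {us = us} (Linked.tail l) ps
  ... | no o  | c≺us = p o ∷ c≺us
  ... | yes e | c≺us with us | l | c≺us
  ...   | []    | s ∷ _ | []         = proj₂ s e ∷ []
  ...   | _ ∷ _ | s ∷ _ | c≺b ∷ c≺bs = <-trans c≺b (proj₂ s e) ∷ c≺b ∷ c≺bs

  module _ {v c : V} {us ws : List V} (k : Class v) (D : Decodable v (us ++ c ∷ ws))
           (c<us : All (Before k c) us) (c<ws : All (Before k c) ws) where
    open Decodable D

    private
      links : Linked Step (us ∷ʳ c) × Linked Step (c ∷ ws ∷ʳ v)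
      links = Linked-++⁻ us (subst (Linked Step) (++-assoc us (c ∷ ws) (v ∷ [])) linked)

      bound-c : Bound v c
      bound-c = All.lookup bound (∈-++⁺ʳ us (here refl))

    -- If c had the wrong parity, the letter after c (the next one in ws, or v)
    -- would violate Step.
    least-admissible : Admissible k c × Decodable c us
    least-admissible = go k c<us c<ws
      where
      go : (k : Class v) → All (Before k c) us → All (Before k c) ws → Admissible k c × Decodable c us
      go (even e) c<us c<ws = (o , ¬r) , record
        { linked = proj₁ links
        ; bound  = All.map (λ p → (λ _ → p) , λ e → contradiction e o) c<us
        ; no-ℛ   = λ _ → All.++⁻ˡ us (no-ℛ λ r → proj₁ r e)
        }
        where
        o : O c
        o e′ = let _ , s , c≺b = next (proj₂ links) c<ws (proj₂ bound-c e) in <-asym c≺b (proj₂ s e′)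
        ¬r : ¬ R c
        ¬r = All.lookup (no-ℛ λ r → proj₁ r e) (∈-++⁺ʳ us (here refl))
      go (odd o ¬r) c<us c<ws with even? A m c
      ... | yes e = e , record
        { linked = proj₁ links
        ; bound  = All.map (λ p → (λ o → contradiction e o) , λ _ → p) c<us
        ; no-ℛ   = λ _ → All.++⁻ˡ us (no-ℛ ¬r)
        }
      ... | no o′ = let _ , s , b≺c = next (proj₂ links) c<ws (proj₁ bound-c o) in contradiction
        (proj₁ s o′ (All.lookup (no-ℛ ¬r) (∈-++⁺ʳ us (here refl)))) (<-asym b≺c)
      go (odd-ℛ r) c<us c<ws with ℛ? A m c | even? A m c
      ... | yes r′ | _     = inj₂ (proj₁ r′ , r′) , record
        { linked = proj₁ links
        -- For an even letter `d`, `ℛ-Before c d` says nothing about size, so its bound is obtained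
        -- along the word from the odd letters.
        ; bound  = All.map (λ p → (λ _ → p) , λ e → contradiction e (proj₁ r′))
                     (odds-above (proj₁ links) (All.map above c<us))
        ; no-ℛ   = contradiction r′
        }
        where
        above : ∀ {d} → ℛ-Before c d → O d → c ≺ d
        above (asc _ _ c≺d)  _ = c≺d
        -- The shape of ℛ enters: an odd letter outside ℛ exceeds `m`, whereas `c` is at most `m`.
        above (first _ ¬r)   o = ≤-<-trans (proj₂ r′) (≰⇒> λ ≤m → ¬r (o , ≤m))
        above (desc ¬r _ _)  _ = contradiction r′ ¬r
      ... | no ¬r  | yes e = inj₁ e , record
        { linked = proj₁ links
        ; bound  = All.map (λ p → (λ o → contradiction e o) , λ _ → below p) c<us
        -- Letters of ℛ come first in this order, so a least letter outside ℛ leaves none of them in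
        -- `us`.
        ; no-ℛ   = λ _ → All.map others c<us
        }
        where
        below : ∀ {d} → ℛ-Before c d → d ≺ c
        below (asc r _ _)    = contradiction r ¬r
        below (first r _)    = contradiction r ¬r
        below (desc _ _ d≺c) = d≺c
        others : ∀ {d} → ℛ-Before c d → ¬ R d
        others (asc r _ _)   = contradiction r ¬r
        others (first r _)   = contradiction r ¬r
        others (desc _ ¬r _) = ¬r
      ... | no ¬r  | no o  =
        let _ , s , b≺c = next (proj₂ links) (All.map below c<ws) (proj₁ bound-c (proj₁ r)) in
        contradiction (proj₁ s o ¬r) (<-asym b≺c)
        where
        below : ∀ {d} → ℛ-Before c d → d ≺ c
        below (asc r _ _)    = contradiction r ¬r
        below (first r _)    = contradiction r ¬r
        below (desc _ _ d≺c) = d≺c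

    Decodable-rest : Decodable v ws
    Decodable-rest = record
      { linked = Linked.tail (proj₂ links)
      ; bound  = All.tail (All.++⁻ʳ us bound)
      ; no-ℛ   = λ ¬r → All.tail (All.++⁻ʳ us (no-ℛ ¬r))
      }

  -- The pieces `us` and `ws` are not structural parts of the word, so `l` bounds the length and
  -- carries the recursion.
  decode : ∀ l v w → length w ≤ l → Unique w → Decodable v w → Decoding v w
  decode l       v []       _         _ _ = record
    { forest = [] ; word = refl ; admits = [] ; isDIDs = [] ; canonical = [] }
  decode (suc l) v (x ∷ xs) (s≤s len) ! D
    with us , c , ws , eq , c<us , c<ws ← least (Before-trans (classify v)) (Before-connex (classify v)) x xs ! =
    record
      { forest    = node c (forest below) ∷ forest rest
      ; word      = trans (pwForest-node c (forest below) (forest rest))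
                      (trans (cong (_++ c ∷ pwForest (forest rest)) (word below))
                        (trans (cong (λ ys → us ++ c ∷ ys) (word rest)) (sym eq)))
      ; admits    = proj₁ adm ∷ admits rest
      ; isDIDs    = node (mkDIDCondition (classify c) (admits below)
                      (subst (All (Bound c)) (sym (word below)) (Decodable.bound (proj₂ adm)))) (isDIDs below)
                    ∷ isDIDs rest
      ; canonical = cons (subst (All _) (sym (word below)) c<us) (subst (All _) (sym (word rest)) c<ws)
                      (canonical below) (canonical rest)
      }
    where
    open Decoding
    D′ : Decodable v (us ++ c ∷ ws)
    D′ = subst (Decodable v) eq D
    adm : Admissible (classify v) c × Decodable c us
    adm = least-admissible (classify v) D′ c<us c<ws
    !′ : Unique us × Unique (c ∷ ws) × _
    !′ = AllPairs-++⁻ us (subst Unique eq !)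
    len′ : suc (length us + length ws) ≤ suc l
    len′ = subst (_≤ suc l) (trans (cong length eq) (trans (length-++ us) (+-suc (length us) _))) (s≤s len)
    below : Decoding c us
    below = decode l c us (≤-trans (m≤m+n _ _) (≤-pred len′)) (proj₁ !′) (proj₂ adm)
    rest : Decoding v ws
    rest = decode l v ws (≤-trans (m≤n+m _ _) (≤-pred len′)) (AllPairs.tail (proj₁ (proj₂ !′)))
          (Decodable-rest (classify v) D′ c<us c<ws)

T-injective : ∀ {x y} → (T x → T y) → (T y → T x) → x ≡ y
T-injective {true}  {true}  _ _ = refl
T-injective {false} {false} _ _ = refl
T-injective {true}  {false} f _ with () ← f tt
T-injective {false} {true}  _ g with () ← g tt

-- The bijection ψ

module Main (A : FinitePositiveSet) (m : ℕ) where
  open FinitePositiveSet A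
  open DID A m

  module _ (t : Tree size) where
    open Trails (Tree.Adj t)

    -- The direction that rests on the DID condition: only admissible children are sure to survive
    -- `hatOrder`.
    rooted≼hat : ∀ d {p v} → IsDID A m (planeFrom (λ _ cs → cs) t d p v) →
                 planeFrom (λ _ cs → cs) t d p v ≼ planeFrom (hatOrder A m) t d p v
    rooted≼hat zero            _            = node []
    rooted≼hat (suc d) {p} {v} did@(node _ ds) = node (map-≼ λ c∈ →
      ⊆hatOrder v (subst (All _) (roots-planeFrom (λ _ cs → cs) t d (just v) _) (admissible did)) c∈ ,
      rooted≼hat d (All.lookup ds (∈-map⁺ (planeFrom (λ _ cs → cs) t d (just v)) c∈)))

    hat-canonical : ∀ d {p v} → IsDID A m (planeFrom (hatOrder A m) t d p v) →
                    Canonical v (children (planeFrom (hatOrder A m) t d p v))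
    hat-canonical zero            _               = []
    hat-canonical (suc d) {p} {v} did@(node _ ds) = mkCanonical ds (admissible did)
      (subst (AllPairs (Precedes v)) (sym (roots-planeFrom (hatOrder A m) t d (just v) _))
        (hatOrder-sorted v (childrenOf-increasing t p v)))
      (All.map⁺ (All.tabulate λ {c} c∈ →
        subst (λ r → Canonical r (children (planeFrom (hatOrder A m) t d (just v) c)))
          (sym (root-planeFrom (hatOrder A m) t d (just v) c))
          (hat-canonical d (All.lookup ds (∈-map⁺ (planeFrom (hatOrder A m) t d (just v)) c∈)))))

    hat-unique : Unique (pw (hat A m t))
    hat-unique = planeFrom-Unique t (λ v → hatOrder⊆ v)
      (λ p v → hatOrder-unique v (childrenOf-increasing t p v)) size zero [] [-]

  module _ (D : DIDTree A m) where
    open DIDTree D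

    hatForest : List (PlaneTree V)
    hatForest = children (hat A m tree)

    hat-isDID : IsDID A m (hat A m tree)
    hat-isDID = IsDID-≼ (planeFrom-≼ tree (λ v → hatOrder⊆ v) size nothing zero) isDID

    hatForest-canonical : Canonical zero hatForest
    hatForest-canonical = hat-canonical tree size hat-isDID

    hat-complete : ∀ v → v ∈ pw (hat A m tree)
    hat-complete v = ≼⇒pw⊆ (rooted≼hat tree size isDID) (planeFrom-complete tree (λ _ c∈ → c∈) zero v)

    Adj⇒hat : ∀ {v w} → Tree.Adj tree v w → ParentOf (hat A m tree) v w ⊎ ParentOf (hat A m tree) w v
    Adj⇒hat = Sum.map (≼⇒ParentOf (rooted≼hat tree size isDID)) (≼⇒ParentOf (rooted≼hat tree size isDID))
              ∘ Adj⇒ParentOf tree (λ _ c∈ → c∈) zero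

    hat⇒Adj : ∀ {v w} → ParentOf (hat A m tree) v w ⊎ ParentOf (hat A m tree) w v → Tree.Adj tree v w
    hat⇒Adj (inj₁ p) = planeFrom-ParentOf tree (λ v → hatOrder⊆ v) size p
    hat⇒Adj (inj₂ p) = Adj-sym tree (planeFrom-ParentOf tree (λ v → hatOrder⊆ v) size p)

  hat-determines-tree : ∀ s t → hat A m (DIDTree.tree s) ≡ hat A m (DIDTree.tree t) →
                        ∀ v w → Tree.edge (DIDTree.tree s) v w ≡ Tree.edge (DIDTree.tree t) v w
  hat-determines-tree s t eq v w = T-injective
    (hat⇒Adj t ∘ subst (λ P → ParentOf P v w ⊎ ParentOf P w v) eq ∘ Adj⇒hat s)
    (hat⇒Adj s ∘ subst (λ P → ParentOf P v w ⊎ ParentOf P w v) (sym eq) ∘ Adj⇒hat t)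

  -- Between cyclic words and ℛ-D-permutations

  -- A D-permutation may have fixed points; the inequalities become strict between consecutive
  -- letters because these are distinct.
  WeakStep : V → V → Set
  WeakStep a b = (O a → ¬ R a → element a ≤ element b) × (E a → element b ≤ element a)

  Step⇒WeakStep : ∀ {a b} → Step a b → WeakStep a b
  Step⇒WeakStep (p , q) = (λ o ¬r → <⇒≤ (p o ¬r)) , <⇒≤ ∘ q

  element-injective : ∀ {a b} → element a ≡ element b → a ≡ b
  element-injective {a} {b} eq with a Fin.≟ b
  ... | yes a≡b = a≡b
  ... | no a≢b with ≺-connex a≢b
  ...   | inj₁ p = contradiction p (<-irrefl eq)
  ...   | inj₂ p = contradiction p (<-irrefl (sym eq))

  WeakStep⇒Step : ∀ {a b} → a ≢ b → WeakStep a b → Step a b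
  WeakStep⇒Step a≢b (p , q) = (λ o ¬r → ≤∧≢⇒< (p o ¬r) (a≢b ∘ element-injective)) ,
                              λ e → ≤∧≢⇒< (q e) (a≢b ∘ sym ∘ element-injective)

  Linked-WeakStep⇒Step : ∀ {xs} → Unique xs → Linked WeakStep xs → Linked Step xs
  Linked-WeakStep⇒Step _                   []      = []
  Linked-WeakStep⇒Step _                   [-]     = [-]
  Linked-WeakStep⇒Step ((a≢b ∷ _) ∷ !) (s ∷ l) = WeakStep⇒Step a≢b s ∷ Linked-WeakStep⇒Step ! l

  zero≺ : ∀ {v} → zero ≢ v → zero ≺ v
  zero≺ {v} zero≢v = ≤∧≢⇒< (zero-least v) (zero≢v ∘ element-injective)

  IsDPermutation-word : ∀ {σ} us → σ IsCycle (us ∷ʳ zero) → Linked Step (us ∷ʳ zero) → All (Bound zero) us →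
                        IsDPermutation A m σ
  IsDPermutation-word {σ} us cyc l bd = record
    { odd-¬ℛ = λ i → proj₁ (step i)
    ; even   = λ i → proj₂ (step i)
    }
    where
    cyc′ : σ IsCycle (zero ∷ us)
    cyc′ = IsCycle-++-comm us (zero ∷ []) cyc
    -- The step out of the root closes the cycle and is not seen by the word. It is a fixed point if
    -- there is no other letter; otherwise an even root would exceed its descendants, against
    -- minimality.
    first-step : ∀ us → All (Bound zero) us → Linked WeakStep (us ∷ʳ zero) → Linked WeakStep (zero ∷ us ∷ʳ zero)
    first-step []      _        l = ((λ _ _ → ≤-refl) , λ _ → ≤-refl) ∷ l
    first-step (b ∷ _) (bd ∷ _) l =
      ((λ _ _ → zero-least b) , λ e → contradiction (proj₂ bd e) (≤⇒≯ (zero-least b))) ∷ l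
    step : ∀ i → WeakStep i (σ ⟨$⟩ʳ i)
    step i = All.lookup (Linked⇒All WeakStep (σ ⟨$⟩ʳ_) zero us
      (first-step us bd (Linked.map Step⇒WeakStep l)) (_IsCycle_.cyclic cyc′)) (_IsCycle_.complete cyc′ i)

  Decodable-word : ∀ {σ} us → IsDPermutation A m σ → σ IsCycle (us ∷ʳ zero) → Decodable zero us
  Decodable-word {σ} us dp cyc = record
    { linked = Linked-WeakStep⇒Step (_IsCycle_.unique cyc) (Linked.tail weak)
    ; bound  = bound us weak (AllPairs.head (_IsCycle_.unique cyc′))
    ; no-ℛ   = no-ℛ us weak (AllPairs.head (_IsCycle_.unique cyc′))
    }
    where
    cyc′ : σ IsCycle (zero ∷ us)
    cyc′ = IsCycle-++-comm us (zero ∷ []) cyc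
    weak : Linked WeakStep (zero ∷ us ∷ʳ zero)
    weak = All⇒Linked WeakStep (σ ⟨$⟩ʳ_) zero us
      (All.tabulate λ {a} _ → IsDPermutation.odd-¬ℛ dp a , IsDPermutation.even dp a) (_IsCycle_.cyclic cyc′)
    -- An even smallest element could only be mapped to itself, which another letter excludes.
    zero-odd : ∀ {b us} → WeakStep zero b → All (zero ≢_) (b ∷ us) → O zero
    zero-odd (_ , q) (zero≢b ∷ _) e = contradiction (q e) (<⇒≱ (zero≺ zero≢b))
    bound : ∀ us → Linked WeakStep (zero ∷ us ∷ʳ zero) → All (zero ≢_) us → All (Bound zero) us
    bound []       _       _   = []
    bound (b ∷ us) (s ∷ _) us≢ = All.map
      (λ zero≢d → (λ _ → zero≺ zero≢d) , λ e → contradiction e (zero-odd s us≢)) us≢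
    no-ℛ : ∀ us → Linked WeakStep (zero ∷ us ∷ʳ zero) → All (zero ≢_) us → ¬ R zero → All (¬_ ∘ R) us
    no-ℛ []      _       _   _  = []
    -- A letter of ℛ is at most `m`, hence so is the odd smallest element, which would then lie in
    -- ℛ.
    no-ℛ (_ ∷ _) (s ∷ _) us≢ ¬r = All.tabulate λ {d} _ (o , d≤m) →
      ¬r (zero-odd s us≢ , ≤-trans (zero-least d) d≤m)

  ψ : DIDTree A m → DCycle A m
  ψ D = record
    { perm           = cycle word word! word∋
    ; isDPermutation = IsDPermutation-word (pwForest (hatForest D)) isCyc
                         (Canonical⇒Linked (hat-isDID D) (hatForest-canonical D)) (bounded (hat-isDID D))
    ; isCycle        = word , isCyc
    }
    where
    word = pw (hat A m (DIDTree.tree D))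
    word! = hat-unique (DIDTree.tree D)
    word∋ = hat-complete D
    isCyc = cycle-isCycle word word! word∋

  ψ-isCycle : ∀ t → DCycle.perm (ψ t) IsCycle pw (hat A m (DIDTree.tree t))
  ψ-isCycle t = proj₂ (DCycle.isCycle (ψ t))

  ψ-injective : ∀ s t → DCycle.perm (ψ s) Perm.≈ DCycle.perm (ψ t) →
                ∀ v w → Tree.edge (DIDTree.tree s) v w ≡ Tree.edge (DIDTree.tree t) v w
  ψ-injective s t eq = hat-determines-tree s t (cong (node zero) (Canonical-unique
    (proj₂ (pw-node⁻ (hatForest s) (hat-unique (DIDTree.tree s))))
    (hatForest-canonical s) (hatForest-canonical t)
    (IsCycle-unique (pwForest (hatForest s)) (pwForest (hatForest t)) eq (ψ-isCycle s) (ψ-isCycle t))))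

  ψ-surjective : ∀ σ → ∃ λ t → DCycle.perm (ψ t) Perm.≈ DCycle.perm σ
  ψ-surjective σ with IsCycle-endingIn zero (proj₂ (DCycle.isCycle σ))
  ... | us , cyc = D , IsCycle-functional
          (subst (λ Q → DCycle.perm (ψ D) IsCycle pw Q) (planeFrom-toTree ordered) (ψ-isCycle D))
          (subst (λ w → DCycle.perm σ IsCycle (w ∷ʳ zero)) (sym word) cyc)
    where
    dec = Decodable-word us (DCycle.isDPermutation σ) cyc
    open Decoding (decode (length us) zero us ≤-refl
      (proj₁ (AllPairs-++⁻ us (_IsCycle_.unique cyc))) dec)
    P : PlaneTree V
    P = node zero forest
    P-isCycle : DCycle.perm σ IsCycle pw P
    P-isCycle = subst (λ w → DCycle.perm σ IsCycle (w ∷ʳ zero)) (sym word) cyc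
    P-isDID : IsDID A m P
    P-isDID = node (mkDIDCondition (classify zero) admits
      (subst (All (Bound zero)) (sym word) (Decodable.bound dec))) isDIDs
    open FromPlane P (_IsCycle_.unique P-isCycle) (_IsCycle_.complete P-isCycle)
    D : DIDTree A m
    D = record
      { tree  = toTree
      ; isDID = IsDID-≼ (planeFrom-toTree-≼ size here root-IsParent) P-isDID
      }
    canonical-at : ∀ {v ts} → node v ts ∈ᵀ P → Canonical v ts
    canonical-at here      = canonical
    canonical-at (there p) = Canonical-subtree p canonical
    -- The decoded forest and `hatOrder` list the same children sorted by the same asymmetric order,
    -- so `hat` of the constructed graph is literally `P`.
    ordered : ∀ {v ts cs} → node v ts ∈ᵀ P → AllPairs Fin._<_ cs →
              cs ⊆ map root ts → map root ts ⊆ cs → hatOrder A m v cs ≡ map root ts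
    ordered {v} {ts} {cs} p cs< cs⊆ ⊆cs = AllPairs-⊆-antisym (Before-asym (classify v))
      (hatOrder-sorted v cs<) (Canonical-roots (canonical-at p))
      (cs⊆ ∘ hatOrder⊆ v) (⊆hatOrder v (All.anti-mono cs⊆ (admissible (IsDID-subtree p P-isDID))) ∘ ⊆cs)

  ψ-bijection : Bijection (𝒯 A m) (ℛ𝒟𝒞 A m)
  ψ-bijection = record
    { to        = ψ
    ; cong      = λ {s} {t} → ψ-cong s t
    ; bijective = (λ {s} {t} → ψ-injective s t) , λ σ → let t , eq = ψ-surjective σ in
                  t , λ {s} s≈t i → trans (ψ-cong s t s≈t i) (eq i)
    }
    where
    ψ-cong : ∀ s t → (∀ v w → Tree.edge (DIDTree.tree s) v w ≡ Tree.edge (DIDTree.tree t) v w) →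
             DCycle.perm (ψ s) Perm.≈ DCycle.perm (ψ t)
    ψ-cong s t s≈t = IsCycle-functional
      (subst (λ P → DCycle.perm (ψ s) IsCycle pw P)
        (planeFrom-cong (hatOrder A m) {DIDTree.tree s} {DIDTree.tree t} s≈t size nothing zero)
        (ψ-isCycle s))
      (ψ-isCycle t)

  -- Finiteness of the set of ℛ-D-cycles

  IsDPermutation? : ∀ σ → Dec (IsDPermutation A m σ)
  IsDPermutation? σ = map′
    (λ h → record { odd-¬ℛ = λ i → proj₁ (h i) ; even = λ i → proj₂ (h i) })
    (λ d i → IsDPermutation.odd-¬ℛ d i , IsDPermutation.even d i)
    (Fin.all? λ i →
      (¬? (even? A m i) →-dec ¬? (ℛ? A m i) →-dec element i ≤? element (σ ⟨$⟩ʳ i)) ×-dec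
      (even? A m i →-dec element (σ ⟨$⟩ʳ i) ≤? element i))

  IsDPermutation-resp-≈ : ∀ {σ τ} → σ Perm.≈ τ → IsDPermutation A m σ → IsDPermutation A m τ
  IsDPermutation-resp-≈ σ≈τ d = record
    { odd-¬ℛ = λ i o ¬r → subst (λ j → element i ≤ element j) (σ≈τ i) (IsDPermutation.odd-¬ℛ d i o ¬r)
    ; even   = λ i e → subst (λ j → element j ≤ element i) (σ≈τ i) (IsDPermutation.even d i e)
    }

  ℛ𝒟𝒞-decSetoid : DecSetoid 0ℓ 0ℓ
  ℛ𝒟𝒞-decSetoid = record
    { isDecEquivalence = record
      { isEquivalence = Setoid.isEquivalence (ℛ𝒟𝒞 A m)
      ; _≟_           = λ σ τ → Fin.all? λ i → DCycle.perm σ ⟨$⟩ʳ i Fin.≟ DCycle.perm τ ⟨$⟩ʳ i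
      }
    }

  ℛ𝒟𝒞-finite : ∃ (HasCardinality (ℛ𝒟𝒞 A m))
  ℛ𝒟𝒞-finite = coded⇒HasCardinality ℛ𝒟𝒞-decSetoid (λ w σ → DCycle.perm σ IsCycle w) isCycle?
    IsCycle-functional (wordsUpTo size)
    λ σ → let w , cyc = DCycle.isCycle σ in
          w , ∈-wordsUpTo size (Unique⇒length≤ (_IsCycle_.unique cyc)) , cyc
    where
    open import Data.List.Membership.DecPropositional (Fin._≟_ {size}) using (_∈?_)
    isCycle? : ∀ w → Dec (∃ λ σ → DCycle.perm σ IsCycle w)
    isCycle? w with Unique.unique? Fin._≟_ w | Fin.all? (_∈? w)
    ... | no ¬! | _      = no λ (_ , cyc) → ¬! (_IsCycle_.unique cyc)
    ... | yes _ | no ¬∋  = no λ (_ , cyc) → ¬∋ (_IsCycle_.complete cyc)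
    -- A word describes only one permutation up to `≈`, so testing this single candidate settles the
    -- existential.
    ... | yes ! | yes ∋ with IsDPermutation? (cycle w ! ∋)
    ...   | yes d = yes (record { perm = cycle w ! ∋ ; isDPermutation = d ; isCycle = w , cycle-isCycle w ! ∋ }
                        , cycle-isCycle w ! ∋)
    ...   | no ¬d = no λ (σ , cyc) → ¬d (IsDPermutation-resp-≈
      (IsCycle-functional cyc (cycle-isCycle w ! ∋)) (DCycle.isDPermutation σ))

theorem4p6 : (A : FinitePositiveSet) (m : ℕ) → m ≥ 1 → Odd m →
    (∃ λ (ψ : Bijection (𝒯 A m) (ℛ𝒟𝒞 A m)) →
       ∀ (t : DIDTree A m) →
         DCycle.perm (Bijection.to ψ t) IsCycle pw (hat A m (DIDTree.tree t)))
    × (∃ λ (c : ℕ) → HasCardinality (𝒯 A m) c × HasCardinality (ℛ𝒟𝒞 A m) c)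
theorem4p6 A m _ _ =
  (ψ-bijection , ψ-isCycle) ,
  let c , card = ℛ𝒟𝒞-finite in c , inverse (Bijection⇒Inverse ψ-bijection) card , card
  where open Main A m
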